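{- For any integers $\alpha \ge 1$ and $n\ge 0$, we have \[\mathrm{pod}_{ -3}\Big(3^{2\alpha +2}n+\frac{23\times 3^{2\alpha +1}+3}{8}\Big)\equiv 0 \pmod{9}.\]
   Context: $\mathrm{pod}_{ -3}(n)$ denotes the number of partition triples of $n$ in which the odd parts in each of the three partitions are distinct. Equivalently, as formal power series, \[\sum_{n=0}^{\infty}\mathrm{pod}_{ -3}(n)q^n=\frac{(-q;q^2)_\infty^3}{(q^2;q^2)_\infty^3}=\frac{1}{\psi(-q)^3},\] where $\psi(q)=\sum_{n=0}^{\infty}q^{n(n+1)/2}$ and $(a;q)_\infty=\prod_{k\ge 0}(1-aq^k)$. -}

module Defs where

open import Data.List using (List; []; _∷_; length; filter; upTo; cartesianProduct; cartesianProductWith)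
open import Data.List.Membership.Propositional using (_∈_)
open import Data.List.Membership.Propositional.Properties
  using (∈-filter⁺; ∈-filter⁻; ∈-upTo⁺; ∈-cartesianProduct⁺; ∈-cartesianProductWith⁺; ∈-cartesianProductWith⁻)
open import Data.List.Properties using (∷-injective)
open import Data.List.Relation.Unary.All using (All; []; _∷_; all?; tabulate)
open import Data.List.Relation.Unary.AllPairs using ([]; _∷_)
open import Data.List.Relation.Unary.Any using (here; there)
open import Data.List.Relation.Unary.Linked using (Linked; linked?)
open import Data.List.Relation.Unary.Unique.Propositional using (Unique)
open import Data.List.Relation.Unary.Unique.Propositional.Properties
  using (upTo⁺; cartesianProductWith⁺; cartesianProduct⁺; filter⁺)
open import Data.Nat
open import Data.Nat.ListAction using (sum)
open import Data.Nat.Divisibility using (_∣_; _∣?_; divides; ∣m∣n⇒∣m+n; ∣n⇒∣m*n)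
open import Data.Nat.Properties
open import Data.Nat.Tactic.RingSolver using (solve-∀)
open import Data.Product using (_×_; _,_; proj₂)
open import Function using (_⇔_; mk⇔)
open import Relation.Binary.PropositionalEquality using (_≡_; refl; sym; subst; cong)
open import Relation.Nullary using (¬_; Dec)
open import Relation.Nullary.Decidable using (¬?; _×-dec_)
open import Relation.Unary using (Decidable)

import Data.List.Relation.Unary.Unique.DecPropositional _≟_ as DecUnique

Odd : ℕ → Set
Odd k = ¬ (2 ∣ k)

odd? : Decidable Odd
odd? k = ¬? (2 ∣? k)

IsPartition : List ℕ → Set
IsPartition ps = Linked _≥_ ps × All (1 ≤_) ps

OddPartsDistinct : List ℕ → Set
OddPartsDistinct ps = Unique (filter odd? ps)

IsPOD : List ℕ → Set
IsPOD ps = IsPartition ps × OddPartsDistinct ps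

isPOD? : Decidable IsPOD
isPOD? ps = (linked? _≥?_ ps ×-dec all? (1 ≤?_) ps) ×-dec DecUnique.unique? (filter odd? ps)

Triple : Set
Triple = List ℕ × List ℕ × List ℕ

IsPODTriple : ℕ → Triple → Set
IsPODTriple n (λ₁ , λ₂ , λ₃) =
  IsPOD λ₁ × IsPOD λ₂ × IsPOD λ₃ × sum λ₁ + sum λ₂ + sum λ₃ ≡ n

isPODTriple? : ∀ n → Decidable (IsPODTriple n)
isPODTriple? n (λ₁ , λ₂ , λ₃) =
  isPOD? λ₁ ×-dec isPOD? λ₂ ×-dec isPOD? λ₃ ×-dec (sum λ₁ + sum λ₂ + sum λ₃ ≟ n)

-- All lists of length at most ℓ with entries at most n, each occurring once.
-- Every partition of size at most n has at most n parts, each at most n, so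
-- boundedLists n n contains all of them; this is only a finite search space.
boundedLists : (ℓ n : ℕ) → List (List ℕ)
boundedLists zero    n = [] ∷ []
boundedLists (suc ℓ) n = [] ∷ cartesianProductWith _∷_ (upTo (suc n)) (boundedLists ℓ n)

searchSpace : ℕ → List Triple
searchSpace n = cartesianProduct B (cartesianProduct B B)
  where B = boundedLists n n

podTriples : ℕ → List Triple
podTriples n = filter (isPODTriple? n) (searchSpace n)

pod₋₃ : ℕ → ℕ
pod₋₃ n = length (podTriples n)

-- podTriples n lists every triple satisfying IsPODTriple n exactly once, so
-- pod₋₃ n is the number of such triples: see podTriples-unique and
-- ∈-podTriples below.

boundedLists-unique : ∀ ℓ n → Unique (boundedLists ℓ n)
boundedLists-unique zero    n = [] ∷ []
boundedLists-unique (suc ℓ) n =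
  tabulate []≢ ∷
  cartesianProductWith⁺ _∷_ ∷-injective (upTo⁺ (suc n)) (boundedLists-unique ℓ n)
  where
  []≢ : ∀ {xs} → xs ∈ cartesianProductWith _∷_ (upTo (suc n)) (boundedLists ℓ n) → ¬ ([] ≡ xs)
  []≢ xs∈ refl with ∈-cartesianProductWith⁻ _∷_ (upTo (suc n)) (boundedLists ℓ n) xs∈
  ... | _ , _ , _ , _ , ()

∈-boundedLists : ∀ ℓ n {ps} → All (1 ≤_) ps → sum ps ≤ ℓ → sum ps ≤ n → ps ∈ boundedLists ℓ n
∈-boundedLists zero    n {[]}         _          _   _   = here refl
∈-boundedLists zero    n {zero ∷ _}   (() ∷ _)   _   _
∈-boundedLists (suc ℓ) n {[]}         _          _   _   = here refl
∈-boundedLists (suc ℓ) n {zero ∷ _}   (() ∷ _)   _   _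
∈-boundedLists (suc ℓ) n {suc p ∷ ps} (_ ∷ 1≤ps) s≤ℓ s≤n = there
  (∈-cartesianProductWith⁺ _∷_
    (∈-upTo⁺ (s≤s (m+n≤o⇒m≤o (suc p) s≤n)))
    (∈-boundedLists ℓ n 1≤ps (m+n≤o⇒n≤o p (s≤s⁻¹ s≤ℓ)) (m+n≤o⇒n≤o (suc p) s≤n)))

podTriples-unique : ∀ n → Unique (podTriples n)
podTriples-unique n = filter⁺ (isPODTriple? n) (cartesianProduct⁺ u (cartesianProduct⁺ u u))
  where u = boundedLists-unique n n

∈-podTriples : ∀ n t → t ∈ podTriples n ⇔ IsPODTriple n t
∈-podTriples n t = mk⇔ (λ t∈ → proj₂ (∈-filter⁻ (isPODTriple? n) {xs = searchSpace n} t∈)) (to t)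
  where
  to : ∀ t → IsPODTriple n t → t ∈ podTriples n
  to (λ₁ , λ₂ , λ₃) p@(((_ , a₁) , _) , ((_ , a₂) , _) , ((_ , a₃) , _) , Σ≡n) =
    ∈-filter⁺ (isPODTriple? n)
      (∈-cartesianProduct⁺ (bounded a₁ (m+n≤o⇒m≤o (sum λ₁) s₁₂≤n))
        (∈-cartesianProduct⁺ (bounded a₂ (m+n≤o⇒n≤o (sum λ₁) s₁₂≤n))
                             (bounded a₃ (m+n≤o⇒n≤o (sum λ₁ + sum λ₂) Σ≤n))))
      p
    where
    Σ≤n : sum λ₁ + sum λ₂ + sum λ₃ ≤ n
    Σ≤n = ≤-reflexive Σ≡n
    s₁₂≤n : sum λ₁ + sum λ₂ ≤ n
    s₁₂≤n = m+n≤o⇒m≤o (sum λ₁ + sum λ₂) Σ≤n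
    bounded : ∀ {ps} → All (1 ≤_) ps → sum ps ≤ n → ps ∈ boundedLists n n
    bounded a s≤n = ∈-boundedLists n n a s≤n s≤n

-- The natural-number division by 8 in (23 * 3 ^ (2 * α + 1) + 3) / 8 is exact.
8∣23*3^[2α+1]+3 : ∀ α → 8 ∣ 23 * 3 ^ (2 * α + 1) + 3
8∣23*3^[2α+1]+3 zero    = divides 9 refl
8∣23*3^[2α+1]+3 (suc α) = subst (8 ∣_) (sym eq)
  (∣m∣n⇒∣m+n (8∣23*3^[2α+1]+3 α) (divides (23 * x) (*-comm 8 (23 * x))))
  where
  x : ℕ
  x = 3 ^ (2 * α + 1)
  ring : ∀ x → 23 * (3 * (3 * x)) + 3 ≡ (23 * x + 3) + 8 * (23 * x)
  ring = solve-∀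
  eq : 23 * 3 ^ (2 * suc α + 1) + 3 ≡ (23 * x + 3) + 8 * (23 * x)
  eq rewrite +-suc α (α + 0) = ring x

{-# OPTIONS --safe #-}
-- Put q = -X and let φ = Σ q^(k(k+1)/2) be the series ψ(-X) of the paper, so that Σ pod₋₃(n) X^n = φ^(-3). By Shanks's
-- telescoping form of Gauss's identity, φ is the reciprocal of the generating function P of a single partition with
-- distinct odd parts. Write V f for f(X^3) and let f ↦ sec r f extract the exponents r modulo 3. Then
-- φ = V A + q V(V φ), and the product formula for φ gives E · Vφ = φ^4 for its norm E = A^3 + q (Vφ)^3. Modulo 9 one has
-- φ^9 = (Vφ)^3, hence (Vφ)^3 P^3 = φ^6, and extracting exponents three times yields
--   sec 0 (P^3) = φ^5 / (Vφ)^2,  sec 2 (sec 0 (P^3)) = φ^2 Vφ,  sec 2 (sec 2 (sec 0 (P^3))) = φ (Vφ)^2 =: D.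
-- Triangular numbers are never 2 modulo 3, so sec 2 D = 0, and sec 2 (sec 1 D) = - D propagates this zero to all α.
module Submission where

open import Algebra.Bundles using (CommutativeRing; RawRing)
import Algebra.Properties.Semiring.Mult.TCOptimised as Multiples
import Algebra.Solver.Ring as RingSolver
open import Algebra.Solver.Ring.AlmostCommutativeRing using (fromCommutativeRing; _-Raw-AlmostCommutative⟶_)
import Algebra.Solver.Ring.NaturalCoefficients.Default as SemiringSolver
open import Data.Maybe using (Maybe; just; nothing)
open import Data.Nat as ℕ using (ℕ; zero; suc; _%_; _/_; _≤_; _<_; z≤n; s≤s)
open import Data.Nat.DivMod using (m≡m%n+[m/n]*n)
import Data.Nat.Properties as ℕₚ
open import Data.Nat.Tactic.RingSolver using () renaming (solve-∀ to ℕ-solve)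
open import Data.Product using (_,_; ∃; proj₁; proj₂) renaming (_×_ to _∧_)
open import Level using (0ℓ)
open import Relation.Binary.PropositionalEquality as ≡ using (_≡_)
open import Relation.Nullary using (Dec; yes; no; ¬_)

-- The constants come from completing the square. If N is the argument in the theorem, then 8 N - 3
-- = 3^(2α+1) (24 n + 23). The sections 0, 2, 2 read off N = 27 k + 24, that is 8 N - 3 = 27 (8 k +
-- 7). The zero section 2 of D takes k = 3 n + 2, that is 8 k + 7 = 24 n + 23, and each pass through
-- sections 1 and 2 multiplies 8 k + 7 by 9. The classical argument uses cube roots of unity and
-- infinite products. Here a norm is witnessed by an equation f^3 = V a + 3 h, which is
-- multiplicative because products of two multiples of 3 vanish modulo 9, and the products are
-- finite ones that agree with φ to growing order. The congruence for φ^9 rests on the same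
-- equation: cubing it once more removes 3 h, so φ^9 is a series in X^3. With the norm formula, the
-- quotient of φ^9 by (Vφ)^3 then equals its own image under V, and a series with that property is
-- constant. Partitions enter only through removal of the largest part, which gives a two-step
-- recurrence for the series with bounded parts.

-- Formal power series over a commutative ring

module PowerSeries {c ℓ} (R : CommutativeRing c ℓ) where
  private
    module R = CommutativeRing R
    module Sol = SemiringSolver R.commutativeSemiring
  open R using (0#; 1#) renaming (_≈_ to _≈ᴿ_; _+_ to _+ᴿ_; _*_ to _*ᴿ_; -_ to -ᴿ_)
  open import Relation.Binary.Reasoning.Setoid R.setoid

  Series : Set c
  Series = ℕ → R.Carrier

  infix 4 _≋_ _≋[_]_
  record _≋_ (f g : Series) : Set ℓ where
    constructor pointwise
    field at : ∀ n → f n ≈ᴿ g n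
  open _≋_ public

  _≋[_]_ : Series → ℕ → Series → Set ℓ
  f ≋[ m ] g = ∀ n → n < m → f n ≈ᴿ g n

  tail : Series → Series
  tail f n = f (suc n)

  infixl 6 _⊕_
  infixl 7 _⊛_ _·_
  _⊕_ _⊛_ : Series → Series → Series
  (f ⊕ g) n = f n +ᴿ g n
  (f ⊛ g) zero    = f 0 *ᴿ g 0
  (f ⊛ g) (suc n) = f 0 *ᴿ g (suc n) +ᴿ (tail f ⊛ g) n

  ⊖_ : Series → Series
  (⊖ f) n = -ᴿ f n

  𝟘 𝟙 X : Series
  𝟘 n = 0#
  𝟙 zero    = 1#
  𝟙 (suc n) = 0#
  X zero    = 0#
  X (suc n) = 𝟙 n

  _·_ : R.Carrier → Series → Series
  (a · f) n = a *ᴿ f n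

  -- A coefficient of a product involves only coefficients of the same or lower degree. Every
  -- passage to a limit below rests on this.
  ⊛-cong-≤ : ∀ {f f′ g g′} n → (∀ i → i ≤ n → f i ≈ᴿ f′ i) → (∀ i → i ≤ n → g i ≈ᴿ g′ i) →
             (f ⊛ g) n ≈ᴿ (f′ ⊛ g′) n
  ⊛-cong-≤ zero    p q = R.*-cong (p 0 z≤n) (q 0 z≤n)
  ⊛-cong-≤ (suc n) p q = R.+-cong (R.*-cong (p 0 z≤n) (q (suc n) ℕₚ.≤-refl))
    (⊛-cong-≤ n (λ i i≤n → p (suc i) (s≤s i≤n)) (λ i i≤n → q i (ℕₚ.m≤n⇒m≤1+n i≤n)))

  ⊛-cong : ∀ {f f′ g g′} → f ≋ f′ → g ≋ g′ → f ⊛ g ≋ f′ ⊛ g′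
  ⊛-cong p q = pointwise λ n → ⊛-cong-≤ n (λ i _ → at p i) (λ i _ → at q i)

  ⊛-cong-trunc : ∀ {m f f′ g g′} → f ≋[ m ] f′ → g ≋[ m ] g′ → f ⊛ g ≋[ m ] f′ ⊛ g′
  ⊛-cong-trunc p q n n<m = ⊛-cong-≤ n
    (λ i i≤n → p i (ℕₚ.≤-<-trans i≤n n<m)) (λ i i≤n → q i (ℕₚ.≤-<-trans i≤n n<m))

  ⊛-zeroˡ : ∀ f n → (𝟘 ⊛ f) n ≈ᴿ 0#
  ⊛-zeroˡ f zero    = R.zeroˡ _
  ⊛-zeroˡ f (suc n) = R.trans (R.+-cong (R.zeroˡ _) (⊛-zeroˡ f n)) (R.+-identityˡ _)

  ⊛-identityˡ : ∀ f n → (𝟙 ⊛ f) n ≈ᴿ f n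
  ⊛-identityˡ f zero    = R.*-identityˡ _
  ⊛-identityˡ f (suc n) = R.trans (R.+-cong (R.*-identityˡ _) (⊛-zeroˡ f n)) (R.+-identityʳ _)

  -- The defining recursion takes off the lowest coefficient of the left factor, this one that of
  -- the right factor. Comparing the two gives commutativity.
  ⊛-snoc : ∀ f g n → (f ⊛ g) (suc n) ≈ᴿ (f ⊛ tail g) n +ᴿ f (suc n) *ᴿ g 0
  ⊛-snoc f g zero    = R.refl
  ⊛-snoc f g (suc n) = R.trans (R.+-congˡ (⊛-snoc (tail f) g n)) (R.sym (R.+-assoc _ _ _))

  ⊛-comm : ∀ f g n → (f ⊛ g) n ≈ᴿ (g ⊛ f) n
  ⊛-comm f g zero    = R.*-comm _ _
  ⊛-comm f g (suc n) = begin
    (f ⊛ g) (suc n)                       ≈⟨ ⊛-snoc f g n ⟩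
    (f ⊛ tail g) n +ᴿ f (suc n) *ᴿ g 0    ≈⟨ R.+-cong (⊛-comm f (tail g) n) (R.*-comm _ _) ⟩
    (tail g ⊛ f) n +ᴿ g 0 *ᴿ f (suc n)    ≈⟨ R.+-comm _ _ ⟩
    (g ⊛ f) (suc n)                       ∎

  ⊛-distribʳ : ∀ h f g n → ((f ⊕ g) ⊛ h) n ≈ᴿ (f ⊛ h) n +ᴿ (g ⊛ h) n
  ⊛-distribʳ h f g zero    = R.distribʳ _ _ _
  ⊛-distribʳ h f g (suc n) = R.trans
    (R.+-cong (R.distribʳ _ _ _) (⊛-distribʳ h (tail f) (tail g) n))
    (Sol.solve 4 (λ a b c d → (a Sol.:+ b) Sol.:+ (c Sol.:+ d) Sol.:= (a Sol.:+ c) Sol.:+ (b Sol.:+ d)) R.refl _ _ _ _)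

  ·-⊛ : ∀ a f g n → ((a · f) ⊛ g) n ≈ᴿ a *ᴿ (f ⊛ g) n
  ·-⊛ a f g zero    = R.*-assoc _ _ _
  ·-⊛ a f g (suc n) = R.trans (R.+-cong (R.*-assoc _ _ _) (·-⊛ a (tail f) g n)) (R.sym (R.distribˡ _ _ _))

  ⊛-assoc : ∀ f g h n → ((f ⊛ g) ⊛ h) n ≈ᴿ (f ⊛ (g ⊛ h)) n
  ⊛-assoc f g h zero    = R.*-assoc _ _ _
  ⊛-assoc f g h (suc n) = begin
    (f 0 *ᴿ g 0) *ᴿ h (suc n) +ᴿ ((f 0 · tail g ⊕ tail f ⊛ g) ⊛ h) n
      ≈⟨ R.+-congˡ (⊛-distribʳ h (f 0 · tail g) (tail f ⊛ g) n) ⟩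
    (f 0 *ᴿ g 0) *ᴿ h (suc n) +ᴿ (((f 0 · tail g) ⊛ h) n +ᴿ ((tail f ⊛ g) ⊛ h) n)
      ≈⟨ R.+-congˡ (R.+-cong (·-⊛ (f 0) (tail g) h n) (⊛-assoc (tail f) g h n)) ⟩
    (f 0 *ᴿ g 0) *ᴿ h (suc n) +ᴿ (f 0 *ᴿ (tail g ⊛ h) n +ᴿ (tail f ⊛ (g ⊛ h)) n)
      ≈⟨ Sol.solve 5 (λ a b c d e → (a Sol.:* b) Sol.:* c Sol.:+ (a Sol.:* d Sol.:+ e)
           Sol.:= a Sol.:* (b Sol.:* c Sol.:+ d) Sol.:+ e) R.refl _ _ _ _ _ ⟩
    f 0 *ᴿ (g 0 *ᴿ h (suc n) +ᴿ (tail g ⊛ h) n) +ᴿ (tail f ⊛ (g ⊛ h)) n ∎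

  series : CommutativeRing c ℓ
  series = record
    { Carrier = Series
    ; _≈_ = _≋_
    ; _+_ = _⊕_
    ; _*_ = _⊛_
    ; -_ = ⊖_
    ; 0# = 𝟘
    ; 1# = 𝟙
    ; isCommutativeRing = record
      { isRing = record
        { +-isAbelianGroup = record
          { isGroup = record
            { isMonoid = record
              { isSemigroup = record
                { isMagma = record
                  { isEquivalence = record
                    { refl = pointwise λ n → R.refl
                    ; sym = λ p → pointwise λ n → R.sym (at p n)
                    ; trans = λ p q → pointwise λ n → R.trans (at p n) (at q n)
                    }
                  ; ∙-cong = λ p q → pointwise λ n → R.+-cong (at p n) (at q n)
                  }
                ; assoc = λ f g h → pointwise λ n → R.+-assoc _ _ _
                }
              ; identity = (λ f → pointwise λ n → R.+-identityˡ _) , (λ f → pointwise λ n → R.+-identityʳ _)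
              }
            ; inverse = (λ f → pointwise λ n → R.-‿inverseˡ _) , (λ f → pointwise λ n → R.-‿inverseʳ _)
            ; ⁻¹-cong = λ p → pointwise λ n → R.-‿cong (at p n)
            }
          ; comm = λ f g → pointwise λ n → R.+-comm _ _
          }
        ; *-cong = ⊛-cong
        ; *-assoc = λ f g h → pointwise (⊛-assoc f g h)
        ; *-identity = (λ f → pointwise (⊛-identityˡ f)) ,
                       (λ f → pointwise λ n → R.trans (⊛-comm f 𝟙 n) (⊛-identityˡ f n))
        ; distrib = (λ f g h → pointwise λ n → R.trans (⊛-comm f (g ⊕ h) n) (R.trans (⊛-distribʳ f g h n)
                      (R.+-cong (⊛-comm g f n) (⊛-comm h f n)))) ,
                    (λ f g h → pointwise (⊛-distribʳ f g h))
        }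
      ; *-comm = λ f g → pointwise (⊛-comm f g)
      }
    }

  private module S = CommutativeRing series
  open import Algebra.Properties.Semiring.Exp S.semiring using (_^_)

  X⊛-zero : ∀ f → (X ⊛ f) 0 ≈ᴿ 0#
  X⊛-zero f = R.zeroˡ _

  X⊛-suc : ∀ f n → (X ⊛ f) (suc n) ≈ᴿ f n
  X⊛-suc f n = R.trans (R.+-cong (R.zeroˡ _) (⊛-identityˡ f n)) (R.+-identityˡ _)

  X^⊛-+ : ∀ k f n → (X ^ k ⊛ f) (k ℕ.+ n) ≈ᴿ f n
  X^⊛-+ zero    f n = ⊛-identityˡ f n
  X^⊛-+ (suc k) f n =
    R.trans (⊛-assoc X (X ^ k) f (suc k ℕ.+ n)) (R.trans (X⊛-suc _ (k ℕ.+ n)) (X^⊛-+ k f n))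

  -- A constant term 1 makes `f` cancellable degree by degree, hence also at finite order. This
  -- stands in for division by finite products.
  ⊛-cancel-trunc : ∀ f {g h} m → f 0 ≈ᴿ 1# → f ⊛ g ≋[ m ] f ⊛ h → g ≋[ m ] h
  ⊛-cancel-trunc f {g} {h} m f₀≈1 eq n n<m = below n n ℕₚ.≤-refl n<m
    where
    open import Algebra.Properties.AbelianGroup R.+-abelianGroup using () renaming (∙-cancelʳ to +-cancelʳ)
    cancel₁ : ∀ {a b} → f 0 *ᴿ a ≈ᴿ f 0 *ᴿ b → a ≈ᴿ b
    cancel₁ p = R.trans (R.sym (one _)) (R.trans p (one _))
      where
      one : ∀ a → f 0 *ᴿ a ≈ᴿ a
      one a = R.trans (R.*-congʳ f₀≈1) (R.*-identityˡ a)
    -- Strong induction on the degree: the bound `n` decreases while `i` ranges over all degrees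
    -- below it, since the tail of the product uses every lower coefficient.
    below : ∀ n i → i ≤ n → i < m → g i ≈ᴿ h i
    below n       zero    _         i<m = cancel₁ (eq 0 i<m)
    below (suc n) (suc i) (s≤s i≤n) i<m = cancel₁ (+-cancelʳ ((tail f ⊛ h) i) _ _
      (R.trans (R.+-congˡ (⊛-cong-≤ {f = tail f} i (λ _ _ → R.refl) λ j j≤i → R.sym (below n j (ℕₚ.≤-trans j≤i i≤n)
        (ℕₚ.≤-<-trans (ℕₚ.m≤n⇒m≤1+n j≤i) i<m)))) (eq (suc i) i<m)))

  ⊛-cancel : ∀ f {g h} → f 0 ≈ᴿ 1# → f ⊛ g ≋ f ⊛ h → g ≋ h
  ⊛-cancel f f₀≈1 eq = pointwise λ n → ⊛-cancel-trunc f (suc n) f₀≈1 (λ i _ → at eq i) n ℕₚ.≤-refl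

  -- Substitution of X^3 and trisection of exponents

  V : Series → Series
  V f zero                = f 0
  V f (suc zero)          = 0#
  V f (suc (suc zero))    = 0#
  V f (suc (suc (suc n))) = V (tail f) n

  sec : ℕ → Series → Series
  sec r f n = f (r ℕ.+ n ℕ.* 3)

  V-cong-≤ : ∀ {f g} n → (∀ i → i ≤ n → f i ≈ᴿ g i) → V f n ≈ᴿ V g n
  V-cong-≤ zero                p = p 0 z≤n
  V-cong-≤ (suc zero)          p = R.refl
  V-cong-≤ (suc (suc zero))    p = R.refl
  V-cong-≤ (suc (suc (suc n))) p = V-cong-≤ n λ i i≤n → p (suc i) (s≤s (ℕₚ.m≤n⇒m≤o+n 2 i≤n))

  V-cong : ∀ {f g} → f ≋ g → V f ≋ V g
  V-cong p = pointwise λ n → V-cong-≤ n λ i _ → at p i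

  V-⊕ : ∀ f g → V (f ⊕ g) ≋ V f ⊕ V g
  V-⊕ f g = pointwise (go f g)
    where
    go : ∀ f g n → V (f ⊕ g) n ≈ᴿ (V f ⊕ V g) n
    go f g zero                = R.refl
    go f g (suc zero)          = R.sym (R.+-identityˡ _)
    go f g (suc (suc zero))    = R.sym (R.+-identityˡ _)
    go f g (suc (suc (suc n))) = go (tail f) (tail g) n

  V-· : ∀ a f n → V (a · f) n ≈ᴿ a *ᴿ V f n
  V-· a f zero                = R.refl
  V-· a f (suc zero)          = R.sym (R.zeroʳ _)
  V-· a f (suc (suc zero))    = R.sym (R.zeroʳ _)
  V-· a f (suc (suc (suc n))) = V-· a (tail f) n

  V-𝟘 : V 𝟘 ≋ 𝟘
  V-𝟘 = pointwise go
    where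
    go : ∀ n → V 𝟘 n ≈ᴿ 0#
    go zero                = R.refl
    go (suc zero)          = R.refl
    go (suc (suc zero))    = R.refl
    go (suc (suc (suc n))) = go n

  V-𝟙 : V 𝟙 ≋ 𝟙
  V-𝟙 = pointwise go
    where
    go : ∀ n → V 𝟙 n ≈ᴿ 𝟙 n
    go zero                = R.refl
    go (suc zero)          = R.refl
    go (suc (suc zero))    = R.refl
    go (suc (suc (suc n))) = at V-𝟘 n

  private
    0*+ : ∀ {x y z} → x ≈ᴿ z → 0# *ᴿ y +ᴿ x ≈ᴿ z
    0*+ q = R.trans (R.+-cong (R.zeroˡ _) q) (R.+-identityˡ _)

  -- Coefficients 1 and 2 of `V f` vanish, so the Cauchy recursion advances three degrees at once.
  -- This makes each section linear over the series in X^3.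
  V⊛-3+ : ∀ f g n → (V f ⊛ g) (3 ℕ.+ n) ≈ᴿ f 0 *ᴿ g (3 ℕ.+ n) +ᴿ (V (tail f) ⊛ g) n
  V⊛-3+ f g n = R.+-congˡ (0*+ (0*+ R.refl))

  V-⊛ : ∀ f g → V (f ⊛ g) ≋ V f ⊛ V g
  V-⊛ f g = pointwise (go f g)
    where
    go : ∀ f g n → V (f ⊛ g) n ≈ᴿ (V f ⊛ V g) n
    go f g zero                = R.refl
    go f g (suc zero)          = R.sym (R.trans (R.+-cong (R.zeroʳ _) (R.zeroˡ _)) (R.+-identityˡ _))
    go f g (suc (suc zero))    = R.sym (R.trans (R.+-cong (R.zeroʳ _)
      (0*+ (R.zeroˡ _))) (R.+-identityˡ _))
    go f g (suc (suc (suc n))) = begin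
      V (f 0 · tail g ⊕ tail f ⊛ g) n              ≈⟨ at (V-⊕ (f 0 · tail g) (tail f ⊛ g)) n ⟩
      V (f 0 · tail g) n +ᴿ V (tail f ⊛ g) n       ≈⟨ R.+-cong (V-· (f 0) (tail g) n) (go (tail f) g n) ⟩
      f 0 *ᴿ V (tail g) n +ᴿ (V (tail f) ⊛ V g) n  ≈⟨ V⊛-3+ f (V g) n ⟨
      (V f ⊛ V g) (3 ℕ.+ n)                        ∎

  sec-cong : ∀ r {f g} → f ≋ g → sec r f ≋ sec r g
  sec-cong r p = pointwise λ n → at p _

  secV⊛₀ : ∀ f g → sec 0 (V f ⊛ g) ≋ f ⊛ sec 0 g
  secV⊛₀ f g = pointwise (go f)
    where
    go : ∀ f n → sec 0 (V f ⊛ g) n ≈ᴿ (f ⊛ sec 0 g) n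
    go f zero    = R.refl
    go f (suc n) = R.trans (V⊛-3+ f g (n ℕ.* 3)) (R.+-congˡ (go (tail f) n))

  secV⊛₁ : ∀ f g → sec 1 (V f ⊛ g) ≋ f ⊛ sec 1 g
  secV⊛₁ f g = pointwise (go f)
    where
    go : ∀ f n → sec 1 (V f ⊛ g) n ≈ᴿ (f ⊛ sec 1 g) n
    go f zero    = R.trans (R.+-congˡ (R.zeroˡ _)) (R.+-identityʳ _)
    go f (suc n) = R.trans (V⊛-3+ f g (suc (n ℕ.* 3))) (R.+-congˡ (go (tail f) n))

  secV⊛₂ : ∀ f g → sec 2 (V f ⊛ g) ≋ f ⊛ sec 2 g
  secV⊛₂ f g = pointwise (go f)
    where
    go : ∀ f n → sec 2 (V f ⊛ g) n ≈ᴿ (f ⊛ sec 2 g) n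
    go f zero    = R.trans (R.+-congˡ (0*+ (R.zeroˡ _))) (R.+-identityʳ _)
    go f (suc n) = R.trans (V⊛-3+ f g (2 ℕ.+ n ℕ.* 3)) (R.+-congˡ (go (tail f) n))

  sec₀-V : ∀ f → sec 0 (V f) ≋ f
  sec₀-V f = pointwise (go f)
    where
    go : ∀ f n → sec 0 (V f) n ≈ᴿ f n
    go f zero    = R.refl
    go f (suc n) = go (tail f) n

  sec₁-V : ∀ f → sec 1 (V f) ≋ 𝟘
  sec₁-V f = pointwise (go f)
    where
    go : ∀ f n → sec 1 (V f) n ≈ᴿ 0#
    go f zero    = R.refl
    go f (suc n) = go (tail f) n

  sec₂-V : ∀ f → sec 2 (V f) ≋ 𝟘
  sec₂-V f = pointwise (go f)
    where
    go : ∀ f n → sec 2 (V f) n ≈ᴿ 0#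
    go f zero    = R.refl
    go f (suc n) = go (tail f) n

  -- Multiplication by `X` permutes the residue classes cyclically. The wrap from 2 to 0 raises the
  -- quotient by one, which leaves a factor `X`.
  sec₀-X : ∀ f → sec 0 (X ⊛ f) ≋ X ⊛ sec 2 f
  sec₀-X f = pointwise λ where
    zero    → R.trans (X⊛-zero f) (R.sym (X⊛-zero (sec 2 f)))
    (suc n) → R.trans (X⊛-suc f (2 ℕ.+ n ℕ.* 3)) (R.sym (X⊛-suc (sec 2 f) n))

  sec₁-X : ∀ f → sec 1 (X ⊛ f) ≋ sec 0 f
  sec₁-X f = pointwise λ n → X⊛-suc f (n ℕ.* 3)

  sec₂-X : ∀ f → sec 2 (X ⊛ f) ≋ sec 1 f
  sec₂-X f = pointwise λ n → X⊛-suc f (suc (n ℕ.* 3))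

  sec-ext : ∀ {f g} → sec 0 f ≋ sec 0 g → sec 1 f ≋ sec 1 g → sec 2 f ≋ sec 2 g → f ≋ g
  sec-ext p₀ p₁ p₂ = pointwise (go (at p₀) (at p₁) (at p₂))
    where
    go : ∀ {f g} → (∀ n → sec 0 f n ≈ᴿ sec 0 g n) → (∀ n → sec 1 f n ≈ᴿ sec 1 g n) →
         (∀ n → sec 2 f n ≈ᴿ sec 2 g n) → ∀ n → f n ≈ᴿ g n
    go p₀ p₁ p₂ zero                = p₀ 0
    go p₀ p₁ p₂ (suc zero)          = p₁ 0
    go p₀ p₁ p₂ (suc (suc zero))    = p₂ 0
    go {f} {g} p₀ p₁ p₂ (suc (suc (suc n))) =
      go {tail (tail (tail f))} {tail (tail (tail g))}
         (λ n → p₀ (suc n)) (λ n → p₁ (suc n)) (λ n → p₂ (suc n)) n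

  -- An arbitrary `u` without constant term covers the powers of `X` and of `q` alike.
  vanish-^ : ∀ u → u 0 ≈ᴿ 0# → ∀ k f n → n < k → (u ^ k ⊛ f) n ≈ᴿ 0#
  vanish-^ u u₀≈0 (suc k) f n (s≤s n≤k) = R.trans (⊛-assoc u (u ^ k) f n) (go n n≤k)
    where
    go : ∀ n → n ≤ k → (u ⊛ (u ^ k ⊛ f)) n ≈ᴿ 0#
    go zero    _   = R.trans (R.*-congʳ u₀≈0) (R.zeroˡ _)
    go (suc n) n<k = R.trans (R.+-cong (R.trans (R.*-congʳ u₀≈0) (R.zeroˡ _))
      (R.trans (⊛-cong-≤ {f = tail u} {g′ = 𝟘} n (λ _ _ → R.refl)
        (λ i i≤n → vanish-^ u u₀≈0 k f i (ℕₚ.≤-<-trans i≤n n<k)))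
        (R.trans (⊛-comm (tail u) 𝟘 n) (⊛-zeroˡ (tail u) n)))) (R.+-identityˡ _)

-- Ring equations modulo 9

NineVanishes : ∀ {c ℓ} → CommutativeRing c ℓ → Set ℓ
NineVanishes S = 9 × 1# ≈ 0#
  where
  open CommutativeRing S
  open Multiples semiring using (_×_)

-- Coefficients are computed as residues, with -1 represented by 8, so the solver also proves
-- identities that hold only modulo 9, such as (e + 3 h)^3 = e^3.
module SolverModNine {c ℓ} (S : CommutativeRing c ℓ) (9≈0 : NineVanishes S) where
  open CommutativeRing S
  open Multiples semiring using (_×_; ×-homo-+; ×1-homo-*)
  open import Algebra.Properties.Ring ring using (+-inverseˡ-unique)
  open import Relation.Binary.Reasoning.Setoid setoid

  ×1-% : ∀ n → (n % 9) × 1# ≈ n × 1#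
  ×1-% n = sym (begin
    n × 1#                                  ≡⟨ ≡.cong (_× 1#) (m≡m%n+[m/n]*n n 9) ⟩
    (n % 9 ℕ.+ n / 9 ℕ.* 9) × 1#            ≈⟨ ×-homo-+ 1# (n % 9) (n / 9 ℕ.* 9) ⟩
    (n % 9) × 1# + (n / 9 ℕ.* 9) × 1#       ≈⟨ +-congˡ (×1-homo-* (n / 9) 9) ⟩
    (n % 9) × 1# + (n / 9) × 1# * (9 × 1#)  ≈⟨ +-congˡ (trans (*-congˡ 9≈0) (zeroʳ _)) ⟩
    (n % 9) × 1# + 0#                       ≈⟨ +-identityʳ _ ⟩
    (n % 9) × 1#                            ∎)

  ×1-neg : ∀ n → ((8 ℕ.* n) % 9) × 1# ≈ - (n × 1#)
  ×1-neg n = trans (×1-% (8 ℕ.* n)) (+-inverseˡ-unique _ _ (begin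
    (8 ℕ.* n) × 1# + n × 1#  ≈⟨ ×-homo-+ 1# (8 ℕ.* n) n ⟨
    (8 ℕ.* n ℕ.+ n) × 1#     ≡⟨ ≡.cong (_× 1#) (ℕₚ.+-comm (8 ℕ.* n) n) ⟩
    (9 ℕ.* n) × 1#           ≈⟨ ×1-homo-* 9 n ⟩
    9 × 1# * (n × 1#)        ≈⟨ trans (*-congʳ 9≈0) (zeroˡ _) ⟩
    0#                       ∎))

  private
    residues : RawRing 0ℓ 0ℓ
    residues = record
      { Carrier = ℕ
      ; _≈_ = _≡_
      ; _+_ = λ m n → (m ℕ.+ n) % 9
      ; _*_ = λ m n → (m ℕ.* n) % 9
      ; -_ = λ n → (8 ℕ.* n) % 9
      ; 0# = 0
      ; 1# = 1
      }

    evaluation : residues -Raw-AlmostCommutative⟶ fromCommutativeRing S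
    evaluation = record
      { ⟦_⟧ = _× 1#
      ; +-homo = λ m n → trans (×1-% (m ℕ.+ n)) (×-homo-+ 1# m n)
      ; *-homo = λ m n → trans (×1-% (m ℕ.* n)) (×1-homo-* m n)
      ; -‿homo = ×1-neg
      ; 0-homo = refl
      ; 1-homo = refl
      }

    _≟_ : ∀ m n → Maybe (m × 1# ≈ n × 1#)
    m ≟ n with m ℕₚ.≟ n
    ... | yes ≡.refl = just refl
    ... | no _       = nothing

  open RingSolver residues (fromCommutativeRing S) evaluation _≟_ public

-- Trisection and norms of series in q = -X

module SeriesModNine {c ℓ} (R : CommutativeRing c ℓ) (9≈0 : NineVanishes R) where
  private module R = CommutativeRing R
  open PowerSeries R
  open CommutativeRing series hiding (zero)
  open import Algebra.Properties.Semiring.Exp semiring using (_^_; ^-assocʳ; ^-congˡ)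
  open import Algebra.Properties.Ring ring using (+-inverseˡ-unique; -‿distribˡ-*; -0#≈0#; -‿involutive)
  open import Relation.Binary.Reasoning.Setoid setoid

  9≋0 : NineVanishes series
  9≋0 = pointwise λ where
      zero    → 9≈0
      (suc n) → drop (drop (drop (drop (drop (drop (drop (drop R.refl)))))))
    where
    drop : ∀ {a} → a R.≈ R.0# → a R.+ R.0# R.≈ R.0#
    drop p = R.trans (R.+-identityʳ _) p

  open SolverModNine series 9≋0 using (solve; _:+_; _:*_; _:-_; :-_; _:=_; con)

  q : Series
  q = - X

  q₀≈0 : q 0 R.≈ R.0#
  q₀≈0 = at -0#≈0# 0

  q*-zero : ∀ f → (q * f) 0 R.≈ R.0#
  q*-zero f = R.trans (R.*-congʳ q₀≈0) (R.zeroˡ _)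

  q*≈-X* : ∀ f → q * f ≈ - (X * f)
  q*≈-X* f = sym (-‿distribˡ-* X f)

  sec₀-q : ∀ f → sec 0 (q * f) ≈ q * sec 2 f
  sec₀-q f = begin
    sec 0 (q * f)      ≈⟨ sec-cong 0 (q*≈-X* f) ⟩
    - sec 0 (X * f)    ≈⟨ -‿cong (sec₀-X f) ⟩
    - (X * sec 2 f)    ≈⟨ q*≈-X* (sec 2 f) ⟨
    q * sec 2 f        ∎

  sec₁-q : ∀ f → sec 1 (q * f) ≈ - sec 0 f
  sec₁-q f = trans (sec-cong 1 (q*≈-X* f)) (-‿cong (sec₁-X f))

  sec₂-q : ∀ f → sec 2 (q * f) ≈ - sec 1 f
  sec₂-q f = trans (sec-cong 2 (q*≈-X* f)) (-‿cong (sec₂-X f))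

  V-neg : ∀ f → V (- f) ≈ - V f
  V-neg f = +-inverseˡ-unique (V (- f)) (V f) (trans (sym (V-⊕ (- f) f)) (trans (V-cong (-‿inverseˡ f)) V-𝟘))

  V-X : V X ≈ X * (X * X)
  V-X = sym (sec-ext
    (trans (sec₀-X (X * X)) (trans (*-congˡ (trans (sec₂-X X) (trans (sec-cong 1 (sym (*-identityʳ X))) (trans (sec₁-X 1#) (sec₀-1)))))
      (trans (*-identityʳ X) (sym (sec₀-V X)))))
    (trans (sec₁-X (X * X)) (trans (sec₀-X X) (trans (*-congˡ (trans (sec-cong 2 (sym (*-identityʳ X))) (trans (sec₂-X 1#) sec₁-1)))
      (trans (zeroʳ X) (sym (sec₁-V X))))))
    (trans (sec₂-X (X * X)) (trans (sec₁-X X) (trans (sec-cong 0 (sym (*-identityʳ X))) (trans (sec₀-X 1#)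
      (trans (*-congˡ sec₂-1) (trans (zeroʳ X) (sym (sec₂-V X)))))))))
    where
    sec₀-1 : sec 0 1# ≈ 1#
    sec₀-1 = trans (sec-cong 0 (sym V-𝟙)) (sec₀-V 1#)
    sec₁-1 : sec 1 1# ≈ 0#
    sec₁-1 = trans (sec-cong 1 (sym V-𝟙)) (sec₁-V 1#)
    sec₂-1 : sec 2 1# ≈ 0#
    sec₂-1 = trans (sec-cong 2 (sym V-𝟙)) (sec₂-V 1#)

  -- The exponent 3 is odd, so the sign in `q` survives and `V` acts on powers of `q` as it does on
  -- powers of `X`.
  V-q : V q ≈ q * q * q
  V-q = begin
    V q              ≈⟨ V-neg X ⟩
    - V X            ≈⟨ -‿cong V-X ⟩
    - (X * (X * X))  ≈⟨ solve 1 (λ x → :- (x :* (x :* x)) := :- x :* :- x :* :- x) refl X ⟩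
    q * q * q        ∎

  V-^ : ∀ f n → V (f ^ n) ≈ V f ^ n
  V-^ f zero    = V-𝟙
  V-^ f (suc n) = trans (V-⊛ f (f ^ n)) (*-congˡ (V-^ f n))

  V-q^ : ∀ n → V (q ^ n) ≈ q ^ (3 ℕ.* n)
  V-q^ n = begin
    V (q ^ n)          ≈⟨ V-^ q n ⟩
    V q ^ n            ≈⟨ ^-congˡ n (trans V-q (solve 1 (λ x → x :* x :* x := x :* (x :* (x :* con 1))) refl q)) ⟩
    (q ^ 3) ^ n        ≈⟨ ^-assocʳ q 3 n ⟩
    q ^ (3 ℕ.* n)      ∎

  q²V : Series → Series
  q²V f = q * (q * V f)

  sec₀-qV : ∀ f → sec 0 (q * V f) ≈ 0#
  sec₀-qV f = trans (sec₀-q (V f)) (trans (*-congˡ (sec₂-V f)) (zeroʳ q))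

  sec₁-qV : ∀ f → sec 1 (q * V f) ≈ - f
  sec₁-qV f = trans (sec₁-q (V f)) (-‿cong (sec₀-V f))

  sec₂-qV : ∀ f → sec 2 (q * V f) ≈ 0#
  sec₂-qV f = trans (sec₂-q (V f)) (trans (-‿cong (sec₁-V f)) -0#≈0#)

  sec₀-q²V : ∀ f → sec 0 (q²V f) ≈ 0#
  sec₀-q²V f = trans (sec₀-q (q * V f)) (trans (*-congˡ (sec₂-qV f)) (zeroʳ q))

  sec₂-q²V : ∀ f → sec 2 (q²V f) ≈ f
  sec₂-q²V f = trans (sec₂-q (q * V f)) (trans (-‿cong (sec₁-qV f)) (-‿involutive f))

  sec₂-sum : ∀ a b c → sec 2 (V a + q * V b + q²V c) ≈ c
  sec₂-sum a b c = trans (+-cong (+-cong (sec₂-V a) (sec₂-qV b)) (sec₂-q²V c))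
    (trans (+-congʳ (+-identityʳ 0#)) (+-identityˡ c))

  -- Modulo 9 the norm ∏ f(ζ X) over the cube roots of unity ζ is the part of f^3 with exponents divisible by 3.
  HasNorm : Series → Series → Set _
  HasNorm f a = ∃ λ h → f * f * f ≈ V a + (h + h + h) ∧ sec 0 h ≈ 0#

  sec₀-V* : ∀ a h → sec 0 h ≈ 0# → sec 0 (V a * h) ≈ 0#
  sec₀-V* a h h₀ = trans (secV⊛₀ a h) (trans (*-congˡ h₀) (zeroʳ a))

  sec₀-triple : ∀ h → sec 0 h ≈ 0# → sec 0 (h + h + h) ≈ 0#
  sec₀-triple h p = trans (+-cong (+-cong p p) p) (trans (+-identityʳ _) (+-identityʳ 0#))

  HasNorm⇒sec₀ : ∀ {f a} → HasNorm f a → sec 0 (f * f * f) ≈ a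
  HasNorm⇒sec₀ {f} {a} (h , f³ , h₀) =
    trans (sec-cong 0 f³) (trans (+-cong (sec₀-V a) (sec₀-triple h h₀)) (+-identityʳ a))

  -- The cross term of the two cubes is 9 h k, which is why the norm is only multiplicative modulo 9.
  hasNorm-* : ∀ {f a g b} → HasNorm f a → HasNorm g b → HasNorm (f * g) (a * b)
  hasNorm-* {f} {a} {g} {b} (h , f³ , h₀) (k , g³ , k₀) = V a * k + V b * h , (begin
    (f * g) * (f * g) * (f * g)
      ≈⟨ solve 2 (λ f g → (f :* g) :* (f :* g) :* (f :* g) := (f :* f :* f) :* (g :* g :* g)) refl f g ⟩
    (f * f * f) * (g * g * g)                        ≈⟨ *-cong f³ g³ ⟩
    (V a + (h + h + h)) * (V b + (k + k + k))
      ≈⟨ solve 4 (λ a b h k → (a :+ (h :+ h :+ h)) :* (b :+ (k :+ k :+ k)) :=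
           a :* b :+ ((a :* k :+ b :* h) :+ (a :* k :+ b :* h) :+ (a :* k :+ b :* h))) refl (V a) (V b) h k ⟩
    V a * V b + (r + r + r)                          ≈⟨ +-congʳ (V-⊛ a b) ⟨
    V (a * b) + (r + r + r)                          ∎) ,
    trans (+-cong (sec₀-V* a k k₀) (sec₀-V* b h h₀)) (+-identityʳ 0#)
    where
    r : Series
    r = V a * k + V b * h

  hasNorm-cong : ∀ {f g a b} → f ≈ g → a ≈ b → HasNorm f a → HasNorm g b
  hasNorm-cong f≈g a≈b (h , f³ , h₀) =
    h , trans (sym (*-cong (*-cong f≈g f≈g) f≈g)) (trans f³ (+-congʳ (V-cong a≈b))) , h₀

  -- A series in X^3 is fixed by X ↦ ζ X, so its norm is a plain cube and the remainder is 0.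
  hasNorm-V : ∀ f → HasNorm (V f) (f * f * f)
  hasNorm-V f = 0# , (begin
    V f * V f * V f               ≈⟨ trans (V-⊛ (f * f) f) (*-congʳ (V-⊛ f f)) ⟨
    V (f * f * f)                 ≈⟨ solve 1 (λ x → x := x :+ (con 0 :+ con 0 :+ con 0)) refl _ ⟩
    V (f * f * f) + (0# + 0# + 0#)  ∎) , refl

  -- In the expanded cube the factor 3 sits on the mixed terms. Since neither `y` nor `y * y` has
  -- exponents divisible by 3, the mixed terms have none either and can serve as the witness `h`.
  hasNorm-V+ : ∀ a {y b} → y * y * y ≈ V b → sec 0 y ≈ 0# → sec 0 (y * y) ≈ 0# →
               HasNorm (V a + y) (a * a * a + b)
  hasNorm-V+ a {y} {b} y³ y₀ y²₀ = h , (begin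
    (V a + y) * (V a + y) * (V a + y)
      ≈⟨ solve 2 (λ a y → (a :+ y) :* (a :+ y) :* (a :+ y) := a :* a :* a :+ y :* y :* y :+
           (h′ a y :+ h′ a y :+ h′ a y)) refl (V a) y ⟩
    V a * V a * V a + y * y * y + (h + h + h)
      ≈⟨ +-congʳ (+-cong (trans (*-congʳ (sym (V-⊛ a a))) (sym (V-⊛ (a * a) a))) y³) ⟩
    V (a * a * a) + V b + (h + h + h)  ≈⟨ +-congʳ (V-⊕ (a * a * a) b) ⟨
    V (a * a * a + b) + (h + h + h)    ∎) ,
    trans (+-cong (sec₀-V* a (V a * y) (sec₀-V* a y y₀)) (sec₀-V* a (y * y) y²₀)) (+-identityʳ 0#)
    where
    h : Series
    h = V a * (V a * y) + V a * (y * y)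
    h′ = λ a y → a :* (a :* y) :+ a :* (y :* y)

-- Gauss's identity

T : ℕ → ℕ
T zero    = 0
T (suc k) = suc k ℕ.+ T k

-- Both this formula and `T-even` split off `suc n`, so that the two new triangular powers in
-- `shanks` are the powers `w ^ suc n` and `w′ ^ suc n`.
T-odd : ∀ n → T (suc (2 ℕ.* n)) ≡ suc (2 ℕ.* n) ℕ.* suc n
T-odd zero    = ≡.refl
T-odd (suc n) rewrite ℕₚ.+-suc n (n ℕ.+ 0) =
  ≡.trans (≡.cong (λ t → 3 ℕ.+ 2 ℕ.* n ℕ.+ (2 ℕ.+ 2 ℕ.* n ℕ.+ t)) (T-odd n)) (arith n)
  where
  arith : ∀ n → 3 ℕ.+ 2 ℕ.* n ℕ.+ (2 ℕ.+ 2 ℕ.* n ℕ.+ suc (2 ℕ.* n) ℕ.* suc n) ≡ (3 ℕ.+ 2 ℕ.* n) ℕ.* (2 ℕ.+ n)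
  arith = ℕ-solve

T-even : ∀ n → T (2 ℕ.+ 2 ℕ.* n) ≡ (3 ℕ.+ 2 ℕ.* n) ℕ.* suc n
T-even n = ≡.trans (≡.cong (2 ℕ.+ 2 ℕ.* n ℕ.+_) (T-odd n)) (arith n)
  where
  arith : ∀ n → 2 ℕ.+ 2 ℕ.* n ℕ.+ suc (2 ℕ.* n) ℕ.* suc n ≡ (3 ℕ.+ 2 ℕ.* n) ℕ.* suc n
  arith = ℕ-solve

-- From 8 T(k) + 1 = (2 k + 1)^2: the index 3 k + 1 triples the odd number 2 k + 1, so the square is
-- multiplied by 9. This is the source of the self-similarity of φ.
T-3k+1 : ∀ k → T (suc (k ℕ.* 3)) ≡ suc (9 ℕ.* T k)
T-3k+1 zero    = ≡.refl
T-3k+1 (suc k) = ≡.trans (≡.cong (λ t → 4 ℕ.+ k ℕ.* 3 ℕ.+ (3 ℕ.+ k ℕ.* 3 ℕ.+ (2 ℕ.+ k ℕ.* 3 ℕ.+ t))) (T-3k+1 k)) (arith k (T k))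
  where
  arith : ∀ k t → 4 ℕ.+ k ℕ.* 3 ℕ.+ (3 ℕ.+ k ℕ.* 3 ℕ.+ (2 ℕ.+ k ℕ.* 3 ℕ.+ suc (9 ℕ.* t))) ≡ suc (9 ℕ.* (suc k ℕ.+ t))
  arith = ℕ-solve

T-3k+2 : ∀ k → T (2 ℕ.+ k ℕ.* 3) ≡ 3 ℕ.* (1 ℕ.+ k ℕ.+ 3 ℕ.* T k)
T-3k+2 k = ≡.trans (≡.cong (2 ℕ.+ k ℕ.* 3 ℕ.+_) (T-3k+1 k)) (arith k (T k))
  where
  arith : ∀ k t → 2 ℕ.+ k ℕ.* 3 ℕ.+ suc (9 ℕ.* t) ≡ 3 ℕ.* (1 ℕ.+ k ℕ.+ 3 ℕ.* t)
  arith = ℕ-solve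

3∣T-3k : ∀ k → ∃ λ e → T (k ℕ.* 3) ≡ 3 ℕ.* e
3∣T-3k zero    = 0 , ≡.refl
3∣T-3k (suc k) = 1 ℕ.+ k ℕ.+ (1 ℕ.+ k ℕ.+ 3 ℕ.* T k) , ≡.trans (≡.cong (3 ℕ.+ k ℕ.* 3 ℕ.+_) (T-3k+2 k)) (arith k (1 ℕ.+ k ℕ.+ 3 ℕ.* T k))
  where
  arith : ∀ k t → 3 ℕ.+ k ℕ.* 3 ℕ.+ 3 ℕ.* t ≡ 3 ℕ.* (1 ℕ.+ k ℕ.+ t)
  arith = ℕ-solve

k≤Tk : ∀ k → k ≤ T k
k≤Tk zero    = z≤n
k≤Tk (suc k) = ℕₚ.m≤m+n (suc k) (T k)

module Triangular {c ℓ} (R : CommutativeRing c ℓ) (9≈0 : NineVanishes R) where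
  private module R = CommutativeRing R
  open PowerSeries R
  open SeriesModNine R 9≈0
  open CommutativeRing series hiding (zero)
  open import Algebra.Properties.Semiring.Exp semiring using (_^_; ^-assocʳ; ^-congˡ)
  open import Algebra.Properties.Ring ring using (-0#≈0#)
  open import Relation.Binary.Reasoning.Setoid setoid
  open SolverModNine series 9≋0 using (solve; _:+_; _:*_; _:-_; :-_; _:=_; con)

  trunc-trans : ∀ {m f g h} → f ≋[ m ] g → g ≋[ m ] h → f ≋[ m ] h
  trunc-trans p r n n<m = R.trans (p n n<m) (r n n<m)

  trunc-sym : ∀ {m f g} → f ≋[ m ] g → g ≋[ m ] f
  trunc-sym p n n<m = R.sym (p n n<m)

  ≋⇒trunc : ∀ {m f g} → f ≋ g → f ≋[ m ] g
  ≋⇒trunc p n _ = at p n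

  trunc-≤ : ∀ {m k f g} → k ≤ m → f ≋[ m ] g → f ≋[ k ] g
  trunc-≤ k≤m p n n<k = p n (ℕₚ.<-≤-trans n<k k≤m)

  q^*-< : ∀ k f n → n < k → (q ^ k * f) n R.≈ R.0#
  q^*-< = vanish-^ q q₀≈0

  q^-< : ∀ k n → n < k → (q ^ k) n R.≈ R.0#
  q^-< k n n<k = R.trans (R.sym (at (*-identityʳ (q ^ k)) n)) (q^*-< k 1# n n<k)

  1-q^ : ℕ → Series
  1-q^ k = 1# - q ^ k

  1-q^suc₀≈1 : ∀ k → 1-q^ (suc k) 0 R.≈ R.1#
  1-q^suc₀≈1 k = R.trans (R.+-congˡ (R.trans (R.-‿cong (q*-zero (q ^ k))) (at -0#≈0# 0))) (R.+-identityʳ _)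

  q^2m : ∀ m → q ^ (2 ℕ.* m) ≈ X ^ (2 ℕ.* m)
  q^2m zero    = refl
  q^2m (suc m) = begin
    q ^ (2 ℕ.* suc m)          ≡⟨ ≡.cong (q ^_) (ℕₚ.*-suc 2 m) ⟩
    q * (q * q ^ (2 ℕ.* m))    ≈⟨ *-congˡ (*-congˡ (q^2m m)) ⟩
    q * (q * X ^ (2 ℕ.* m))    ≈⟨ solve 2 (λ x y → :- x :* (:- x :* y) := x :* (x :* y)) refl X (X ^ (2 ℕ.* m)) ⟩
    X * (X * X ^ (2 ℕ.* m))    ≡⟨ ≡.cong (X ^_) (ℕₚ.*-suc 2 m) ⟨
    X ^ (2 ℕ.* suc m)          ∎

  -- Intended for the series of partitions with parts at most 2 m, 2 m + 1 and 2 m + 2. The odd part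
  -- contributes 1 + X^(2m+1), the even one 1 / (1 - X^(2m+2)). In terms of `q` both factors have
  -- the shape 1 - q^k.
  recurrence : ∀ m {c₀ c₁ c₂} → c₁ ≈ c₀ + X ^ (1 ℕ.+ 2 ℕ.* m) * c₀ → c₂ ≈ c₁ + X ^ (2 ℕ.+ 2 ℕ.* m) * c₂ →
               1-q^ (2 ℕ.+ 2 ℕ.* m) * c₂ ≈ 1-q^ (1 ℕ.+ 2 ℕ.* m) * c₀
  recurrence m {c₀} {c₁} {c₂} odd even = begin
    (1# - q * (q * q ^ (2 ℕ.* m))) * c₂
      ≈⟨ *-congʳ (+-congˡ (-‿cong (*-congˡ (*-congˡ (q^2m m))))) ⟩
    (1# - q * (q * y)) * c₂
      ≈⟨ solve 3 (λ x y c → (con 1 :- :- x :* (:- x :* y)) :* c := c :- x :* (x :* y) :* c) refl X y c₂ ⟩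
    c₂ - X * (X * y) * c₂                      ≈⟨ +-congʳ even ⟩
    c₁ + X * (X * y) * c₂ - X * (X * y) * c₂   ≈⟨ solve 2 (λ a b → a :+ b :- b := a) refl c₁ (X * (X * y) * c₂) ⟩
    c₁                                         ≈⟨ odd ⟩
    c₀ + X * y * c₀
      ≈⟨ solve 3 (λ x y c → c :+ x :* y :* c := (con 1 :- :- x :* y) :* c) refl X y c₀ ⟩
    (1# - q * y) * c₀                          ≈⟨ *-congʳ (+-congˡ (-‿cong (*-congˡ (q^2m m)))) ⟨
    (1# - q * q ^ (2 ℕ.* m)) * c₀              ∎
    where
    y : Series
    y = X ^ (2 ℕ.* m)

  -- The finite q-Pochhammer symbol (q^c; q^2)_m, applied with c = 1 and c = 2.
  Π : ℕ → ℕ → Series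
  Π c zero    = 1#
  Π c (suc m) = Π c m * 1-q^ (c ℕ.+ 2 ℕ.* m)

  ψ : ℕ → Series
  ψ zero    = 0#
  ψ (suc k) = ψ k + q ^ T k

  -- The diagonal of the partial sums: as `T k` is at least `k`, coefficient `n` is settled after
  -- `suc n` terms.
  φ : Series
  φ n = ψ (suc n) n

  ψ-stable : ∀ k n i → n < k → ψ (i ℕ.+ k) n R.≈ ψ k n
  ψ-stable k n zero    n<k = R.refl
  ψ-stable k n (suc i) n<k = R.trans (R.+-cong (ψ-stable k n i n<k)
    (q^-< (T (i ℕ.+ k)) n (ℕₚ.<-≤-trans n<k (ℕₚ.≤-trans (ℕₚ.m≤n+m k i) (k≤Tk (i ℕ.+ k)))))) (R.+-identityʳ _)

  φ≋ψ : ∀ k → φ ≋[ k ] ψ k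
  φ≋ψ k n n<k = R.sym (R.trans
    (R.reflexive (≡.cong (λ j → ψ j n) (≡.sym (ℕₚ.m∸n+n≡m n<k)))) (ψ-stable (suc n) n (k ℕ.∸ suc n) ℕₚ.≤-refl))

  -- The hypotheses determine `G m` as (q; q^2)_m / (q^2; q^2)_m.
  module Shanks (G : ℕ → Series) (G₀ : G 0 ≈ 1#)
                (G-suc : ∀ m → 1-q^ (2 ℕ.+ 2 ℕ.* m) * G (suc m) ≈ 1-q^ (1 ℕ.+ 2 ℕ.* m) * G m) where

    weighted : Series → ℕ → Series
    weighted w zero    = 0#
    weighted w (suc k) = weighted w k + G k * w ^ k

    weighted-cong : ∀ {v w} → v ≈ w → ∀ k → weighted v k ≈ weighted w k
    weighted-cong v≈w zero    = refl
    weighted-cong v≈w (suc k) = +-cong (weighted-cong v≈w k) (*-congˡ (^-congˡ k v≈w))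

    ^-qq : ∀ w k → (q * (q * w)) ^ k ≈ w ^ k * q ^ (2 ℕ.* k)
    ^-qq w zero    = sym (*-identityˡ 1#)
    ^-qq w (suc k) = begin
      q * (q * w) * (q * (q * w)) ^ k       ≈⟨ *-congˡ (^-qq w k) ⟩
      q * (q * w) * (w ^ k * q ^ (2 ℕ.* k))
        ≈⟨ solve 4 (λ q w a b → q :* (q :* w) :* (a :* b) := w :* a :* (q :* (q :* b))) refl q w (w ^ k) _ ⟩
      w ^ suc k * q ^ (2 ℕ.+ 2 ℕ.* k)       ≡⟨ ≡.cong (λ e → w ^ suc k * q ^ e) (≡.sym (ℕₚ.*-suc 2 k)) ⟩
      w ^ suc k * q ^ (2 ℕ.* suc k)         ∎

    -- A finite form of the functional equation (1 - w) F(w) = (1 - q w) F(q^2 w) behind the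
    -- q-binomial theorem, for F(w) = Σ G_k w^k. The last term is the boundary of the truncated sum.
    telescope : ∀ w k → (1# - q * w) * weighted (q * (q * w)) k ≈
                        (1# - w) * weighted w k + w ^ k * (1-q^ (2 ℕ.* k) * G k)
    telescope w zero    = solve 3 (λ q w g → (con 1 :- q :* w) :* con 0 :=
      (con 1 :- w) :* con 0 :+ con 1 :* ((con 1 :- con 1) :* g)) refl q w (G 0)
    telescope w (suc k) = begin
      (1# - q * w) * (weighted (q * (q * w)) k + G k * (q * (q * w)) ^ k)
        ≈⟨ trans (distribˡ _ _ _) (+-cong (telescope w k) (*-congˡ (*-congˡ (^-qq w k)))) ⟩
      (1# - w) * A + W * ((1# - Q) * g) + (1# - q * w) * (g * (W * Q))
        ≈⟨ solve 6 (λ q w A W Q g →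
             (con 1 :- w) :* A :+ W :* ((con 1 :- Q) :* g) :+ (con 1 :- q :* w) :* (g :* (W :* Q)) :=
             (con 1 :- w) :* (A :+ g :* W) :+ w :* W :* ((con 1 :- q :* Q) :* g)) refl q w A W Q g ⟩
      (1# - w) * (A + g * W) + w * W * ((1# - q * Q) * g)
        ≈⟨ +-congˡ (*-congˡ (G-suc k)) ⟨
      (1# - w) * (A + g * W) + w * W * (1-q^ (2 ℕ.+ 2 ℕ.* k) * G (suc k))
        ≡⟨ ≡.cong (λ e → (1# - w) * (A + g * W) + w * W * (1-q^ e * G (suc k))) (≡.sym (ℕₚ.*-suc 2 k)) ⟩
      (1# - w) * (A + g * W) + w * W * (1-q^ (2 ℕ.* suc k) * G (suc k)) ∎
      where
      A W Q g : Series
      A = weighted w k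
      W = w ^ k
      Q = q ^ (2 ℕ.* k)
      g = G k

    -- Passing from n to n + 1 replaces w = q^(2n+1) by q^2 w. The boundary term of `telescope` and
    -- the one extra summand supply exactly the two new powers, with exponents T(2n+1) and T(2n+2).
    shanks : ∀ n → weighted (q ^ suc (2 ℕ.* n)) (suc n) ≈ ψ (suc (2 ℕ.* n)) * G n
    shanks zero    = solve 1 (λ g → con 0 :+ g :* con 1 := (con 0 :+ con 1) :* g) refl (G 0)
    shanks (suc n) = ⊛-cancel (1# - q * w) (1-q^suc₀≈1 (suc (2 ℕ.* n))) (begin
      (1# - q * w) * weighted (q ^ suc (2 ℕ.* suc n)) (2 ℕ.+ n)
        ≈⟨ *-congˡ (weighted-cong (reflexive (≡.cong (λ e → q ^ suc e) (ℕₚ.*-suc 2 n))) (2 ℕ.+ n)) ⟩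
      (1# - q * w) * (weighted w′ (suc n) + G (suc n) * w′ ^ suc n)
        ≈⟨ trans (distribˡ _ _ _) (+-congʳ (telescope w (suc n))) ⟩
      (1# - w) * weighted w (suc n) + w ^ suc n * (1-q^ (2 ℕ.* suc n) * G (suc n))
        + (1# - q * w) * (G (suc n) * w′ ^ suc n)
        ≈⟨ +-congʳ (+-cong (*-congˡ (shanks n))
             (*-congˡ (*-congʳ (reflexive (≡.cong 1-q^ (ℕₚ.*-suc 2 n)))))) ⟩
      (1# - w) * (s * G n) + w ^ suc n * ((1# - q * w) * G (suc n)) + (1# - q * w) * (G (suc n) * w′ ^ suc n)
        ≈⟨ +-congʳ (+-congʳ (trans (solve 3 (λ a s g → a :* (s :* g) := s :* (a :* g)) refl (1# - w) s (G n))
             (*-congˡ (sym (G-suc n))))) ⟩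
      s * ((1# - q * w) * G (suc n)) + w ^ suc n * ((1# - q * w) * G (suc n)) + (1# - q * w) * (G (suc n) * w′ ^ suc n)
        ≈⟨ solve 5 (λ a s g u v → s :* (a :* g) :+ u :* (a :* g) :+ a :* (g :* v) := a :* ((s :+ u :+ v) :* g))
             refl (1# - q * w) s (G (suc n)) (w ^ suc n) (w′ ^ suc n) ⟩
      (1# - q * w) * ((s + w ^ suc n + w′ ^ suc n) * G (suc n))
        ≈⟨ *-congˡ (*-congʳ (+-cong (+-congˡ (power (suc (2 ℕ.* n)) (T-odd n))) (power (3 ℕ.+ 2 ℕ.* n) (T-even n)))) ⟩
      (1# - q * w) * (ψ (3 ℕ.+ 2 ℕ.* n) * G (suc n))
        ≡⟨ ≡.cong (λ e → (1# - q * w) * (ψ (suc e) * G (suc n))) (≡.sym (ℕₚ.*-suc 2 n)) ⟩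
      (1# - q * w) * (ψ (suc (2 ℕ.* suc n)) * G (suc n)) ∎)
      where
      w w′ s : Series
      w  = q ^ suc (2 ℕ.* n)
      w′ = q * (q * w)
      s  = ψ (suc (2 ℕ.* n))
      power : ∀ e {t} → t ≡ e ℕ.* suc n → (q ^ e) ^ suc n ≈ q ^ t
      power e eq = trans (^-assocʳ q e (suc n)) (reflexive (≡.cong (q ^_) (≡.sym eq)))

    -- In the weighted sum every summand except the one for k = 0 contains the factor q^(2n+1).
    ψG≋1 : ∀ n → ψ (suc (2 ℕ.* n)) * G n ≋[ suc (2 ℕ.* n) ] 1#
    ψG≋1 n = trunc-trans (≋⇒trunc (sym (shanks n))) (head n)
      where
      m : ℕ
      m = suc (2 ℕ.* n)
      w : Series
      w = q ^ m
      head : ∀ k → weighted w (suc k) ≋[ m ] 1#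
      head zero    = ≋⇒trunc (trans (+-identityˡ _) (trans (*-identityʳ (G 0)) G₀))
      head (suc k) i i<m = R.trans (R.+-cong (head k i i<m) (R.trans (at rearrange i) (q^*-< m _ i i<m))) (R.+-identityʳ _)
        where
        rearrange : G (suc k) * w ^ suc k ≈ w * (G (suc k) * w ^ k)
        rearrange = solve 3 (λ g w v → g :* (w :* v) := w :* (g :* v)) refl (G (suc k)) w (w ^ k)

    module Limit (P : Series) (G≋P : ∀ n → G n ≋[ suc (2 ℕ.* n) ] P) where

      n<1+2n : ∀ n → n < suc (2 ℕ.* n)
      n<1+2n n = s≤s (ℕₚ.m≤m+n n (n ℕ.+ 0))

      φP≈1 : φ * P ≈ 1#
      φP≈1 = pointwise λ n → R.trans
        (⊛-cong-trunc (φ≋ψ _) (trunc-sym (G≋P n)) n (n<1+2n n)) (ψG≋1 n n (n<1+2n n))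

      GΠ₂≈Π₁ : ∀ m → G m * Π 2 m ≈ Π 1 m
      GΠ₂≈Π₁ zero    = trans (*-identityʳ (G 0)) G₀
      GΠ₂≈Π₁ (suc m) = begin
        G (suc m) * (Π 2 m * v)  ≈⟨ solve 3 (λ g b v → g :* (b :* v) := (v :* g) :* b) refl (G (suc m)) (Π 2 m) v ⟩
        v * G (suc m) * Π 2 m    ≈⟨ *-congʳ (G-suc m) ⟩
        u * G m * Π 2 m          ≈⟨ solve 3 (λ g b v → (v :* g) :* b := g :* b :* v) refl (G m) (Π 2 m) u ⟩
        G m * Π 2 m * u          ≈⟨ *-congʳ (GΠ₂≈Π₁ m) ⟩
        Π 1 m * u                ∎
        where
        u v : Series
        u = 1-q^ (1 ℕ.+ 2 ℕ.* m)
        v = 1-q^ (2 ℕ.+ 2 ℕ.* m)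

      -- Gauss's product formula at finite order with the denominator cleared: the inverse `P` of
      -- `φ` agrees to this order with `G m`, the quotient of the two products.
      φΠ₁≋Π₂ : ∀ m → φ * Π 1 m ≋[ suc (2 ℕ.* m) ] Π 2 m
      φΠ₁≋Π₂ m = trunc-trans (≋⇒trunc (trans (*-congˡ (sym (GΠ₂≈Π₁ m))) (sym (*-assoc φ (G m) (Π 2 m)))))
        (trunc-trans (⊛-cong-trunc {g = Π 2 m} (⊛-cong-trunc {f = φ} (λ _ _ → R.refl) (G≋P m)) (λ _ _ → R.refl))
          (≋⇒trunc (trans (*-congʳ φP≈1) (*-identityˡ (Π 2 m)))))

-- Trisection of φ and the norm of its product formula

module Dissection {c ℓ} (R : CommutativeRing c ℓ) (9≈0 : NineVanishes R) where
  private module R = CommutativeRing R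
  open PowerSeries R
  open SeriesModNine R 9≈0
  open Triangular R 9≈0
  open CommutativeRing series hiding (zero)
  open import Algebra.Properties.Semiring.Exp semiring using (_^_; ^-assocʳ)
  open import Algebra.Properties.Ring ring using (-0#≈0#)
  open import Relation.Binary.Reasoning.Setoid setoid
  open SolverModNine series 9≋0 using (solve; _:+_; _:*_; _:-_; :-_; _:=_; con)

  q^T-3k : ∀ k → ∃ λ f → q ^ T (k ℕ.* 3) ≈ V f
  q^T-3k k with 3∣T-3k k
  ... | e , eq = q ^ e , trans (reflexive (≡.cong (q ^_) eq)) (sym (V-q^ e))

  q^T-3k+1 : ∀ k → q ^ T (1 ℕ.+ k ℕ.* 3) ≈ q * V (V (q ^ T k))
  q^T-3k+1 k = begin
    q ^ T (1 ℕ.+ k ℕ.* 3)         ≡⟨ ≡.cong (q ^_) (T-3k+1 k) ⟩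
    q * q ^ (9 ℕ.* T k)           ≡⟨ ≡.cong (λ e → q * q ^ e) (ℕₚ.*-assoc 3 3 (T k)) ⟩
    q * q ^ (3 ℕ.* (3 ℕ.* T k))   ≈⟨ *-congˡ (trans (V-cong (V-q^ (T k))) (V-q^ (3 ℕ.* T k))) ⟨
    q * V (V (q ^ T k))           ∎

  q^T-3k+2 : ∀ k → ∃ λ f → q ^ T (2 ℕ.+ k ℕ.* 3) ≈ V f
  q^T-3k+2 k = _ , trans (reflexive (≡.cong (q ^_) (T-3k+2 k))) (sym (V-q^ (1 ℕ.+ k ℕ.+ 3 ℕ.* T k)))

  sec₁-V≈0 : ∀ {f} → (∃ λ g → f ≈ V g) → sec 1 f ≈ 0#
  sec₁-V≈0 (g , p) = trans (sec-cong 1 p) (sec₁-V g)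

  sec₂-V≈0 : ∀ {f} → (∃ λ g → f ≈ V g) → sec 2 f ≈ 0#
  sec₂-V≈0 (g , p) = trans (sec-cong 2 p) (sec₂-V g)

  -- Among T(3k), T(3k+1), T(3k+2) only the middle one, 9 T(k) + 1, is 1 modulo 3. The factor 9
  -- amounts to `V` applied twice, and the section undoes one of these.
  sec₁-ψ : ∀ k → sec 1 (ψ (k ℕ.* 3)) ≈ - V (ψ k)
  sec₁-ψ zero    = trans (sym -0#≈0#) (-‿cong (sym V-𝟘))
  sec₁-ψ (suc k) = begin
    sec 1 (ψ (k ℕ.* 3)) + sec 1 (q ^ T (k ℕ.* 3)) + sec 1 (q ^ T (1 ℕ.+ k ℕ.* 3)) + sec 1 (q ^ T (2 ℕ.+ k ℕ.* 3))
      ≈⟨ +-cong (+-cong (+-cong (sec₁-ψ k) (sec₁-V≈0 (q^T-3k k)))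
           (trans (sec-cong 1 (q^T-3k+1 k)) (sec₁-qV (V (q ^ T k))))) (sec₁-V≈0 (q^T-3k+2 k)) ⟩
    - V (ψ k) + 0# + - V (q ^ T k) + 0#
      ≈⟨ solve 2 (λ a b → :- a :+ con 0 :+ :- b :+ con 0 := :- (a :+ b)) refl (V (ψ k)) (V (q ^ T k)) ⟩
    - (V (ψ k) + V (q ^ T k))   ≈⟨ -‿cong (V-⊕ (ψ k) (q ^ T k)) ⟨
    - V (ψ (suc k))             ∎

  sec₂-ψ : ∀ k → sec 2 (ψ (k ℕ.* 3)) ≈ 0#
  sec₂-ψ zero    = refl
  sec₂-ψ (suc k) = begin
    sec 2 (ψ (k ℕ.* 3)) + sec 2 (q ^ T (k ℕ.* 3)) + sec 2 (q ^ T (1 ℕ.+ k ℕ.* 3)) + sec 2 (q ^ T (2 ℕ.+ k ℕ.* 3))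
      ≈⟨ +-cong (+-cong (+-cong (sec₂-ψ k) (sec₂-V≈0 (q^T-3k k)))
           (trans (sec-cong 2 (q^T-3k+1 k)) (sec₂-qV (V (q ^ T k))))) (sec₂-V≈0 (q^T-3k+2 k)) ⟩
    0# + 0# + 0# + 0#  ≈⟨ solve 0 (con 0 :+ con 0 :+ con 0 :+ con 0 := con 0) refl ⟩
    0#                 ∎

  sec₁-φ : sec 1 φ ≈ - V φ
  sec₁-φ = pointwise λ n → R.trans
    (φ≋ψ (suc n ℕ.* 3) (1 ℕ.+ n ℕ.* 3) (ℕₚ.n≤1+n _))
    (R.trans (at (sec₁-ψ (suc n)) n)
      (R.-‿cong (V-cong-≤ n λ i i≤n → R.sym (φ≋ψ (suc n) i (s≤s i≤n)))))

  sec₂-φ : sec 2 φ ≈ 0#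
  sec₂-φ = pointwise λ n → R.trans
    (φ≋ψ (suc n ℕ.* 3) (2 ℕ.+ n ℕ.* 3) ℕₚ.≤-refl) (at (sec₂-ψ (suc n)) n)

  A φ₃ : Series
  A  = sec 0 φ
  φ₃ = V φ

  φ-dissection : φ ≈ V A + q * V φ₃
  φ-dissection = sec-ext
    (sym (trans (+-cong (sec₀-V A) (sec₀-qV φ₃)) (+-identityʳ A)))
    (trans sec₁-φ (sym (trans (+-cong (sec₁-V A) (sec₁-qV φ₃)) (+-identityˡ _))))
    (trans sec₂-φ (sym (trans (+-cong (sec₂-V A) (sec₂-qV φ₃)) (+-identityˡ 0#))))

  E : Series
  E = A * A * A + q * (φ₃ * φ₃ * φ₃)

  V-cube : ∀ f → V (f * f * f) ≈ V f * V f * V f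
  V-cube f = trans (V-⊛ (f * f) f) (*-congʳ (V-⊛ f f))

  hasNorm-φ : HasNorm φ E
  hasNorm-φ = hasNorm-cong (sym φ-dissection) refl (hasNorm-V+ A
    (begin
      q * v * (q * v) * (q * v)
        ≈⟨ solve 2 (λ q v → q :* v :* (q :* v) :* (q :* v) := q :* q :* q :* (v :* v :* v)) refl q v ⟩
      q * q * q * (v * v * v)         ≈⟨ *-cong V-q (V-cube φ₃) ⟨
      V q * V (φ₃ * φ₃ * φ₃)          ≈⟨ V-⊛ q (φ₃ * φ₃ * φ₃) ⟨
      V (q * (φ₃ * φ₃ * φ₃))          ∎)
    (sec₀-qV φ₃)
    (trans (sec-cong 0 (trans (solve 2 (λ q v → q :* v :* (q :* v) := q :* (q :* (v :* v))) refl q v)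
      (*-congˡ (*-congˡ (sym (V-⊛ φ₃ φ₃)))))) (sec₀-q²V (φ₃ * φ₃))))
    where
    v : Series
    v = V φ₃

  -- For k prime to 3 the conjugates of 1 - q^k multiply to 1 - q^(3k), which is `V` of the factor
  -- itself. The two hypotheses encode that 3 divides neither k nor 2 k.
  hasNorm-1-q^ : ∀ k → sec 0 (q ^ k) ≈ 0# → sec 0 (q ^ k * q ^ k) ≈ 0# → HasNorm (1-q^ k) (1-q^ k)
  hasNorm-1-q^ k p₁ p₂ = hasNorm-cong
    (+-congʳ V-𝟙) (+-congʳ (solve 0 (con 1 :* con 1 :* con 1 := con 1) refl))
    (hasNorm-V+ 1#
      (begin
        - y * - y * - y    ≈⟨ solve 1 (λ y → :- y :* :- y :* :- y := :- (y :* (y :* (y :* con 1)))) refl y ⟩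
        - (y ^ 3)          ≈⟨ -‿cong (trans (^-assocʳ q k 3) (reflexive (≡.cong (q ^_) (ℕₚ.*-comm k 3)))) ⟩
        - (q ^ (3 ℕ.* k))  ≈⟨ trans (V-neg y) (-‿cong (V-q^ k)) ⟨
        V (- y)            ∎)
      (trans (-‿cong p₁) -0#≈0#)
      (trans (sec-cong 0 (solve 1 (λ y → :- y :* :- y := y :* y) refl y)) p₂))
    where
    y : Series
    y = q ^ k

  hasNorm-3i+1 : ∀ i → HasNorm (1-q^ (1 ℕ.+ 3 ℕ.* i)) (1-q^ (1 ℕ.+ 3 ℕ.* i))
  hasNorm-3i+1 i = hasNorm-1-q^ (1 ℕ.+ 3 ℕ.* i)
    (trans (sec-cong 0 eq) (sec₀-qV (q ^ i)))
    (trans (sec-cong 0 (begin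
      q ^ (1 ℕ.+ 3 ℕ.* i) * q ^ (1 ℕ.+ 3 ℕ.* i)  ≈⟨ *-cong eq eq ⟩
      q * v * (q * v)    ≈⟨ solve 2 (λ q v → q :* v :* (q :* v) := q :* (q :* (v :* v))) refl q v ⟩
      q * (q * (v * v))  ≈⟨ *-congˡ (*-congˡ (V-⊛ (q ^ i) (q ^ i))) ⟨
      q²V (q ^ i * q ^ i) ∎)) (sec₀-q²V _))
    where
    v : Series
    v = V (q ^ i)
    eq : q ^ (1 ℕ.+ 3 ℕ.* i) ≈ q * v
    eq = *-congˡ (sym (V-q^ i))

  hasNorm-3i+2 : ∀ i → HasNorm (1-q^ (2 ℕ.+ 3 ℕ.* i)) (1-q^ (2 ℕ.+ 3 ℕ.* i))
  hasNorm-3i+2 i = hasNorm-1-q^ (2 ℕ.+ 3 ℕ.* i)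
    (trans (sec-cong 0 eq) (sec₀-q²V (q ^ i)))
    (trans (sec-cong 0 (begin
      q ^ (2 ℕ.+ 3 ℕ.* i) * q ^ (2 ℕ.+ 3 ℕ.* i)  ≈⟨ *-cong eq eq ⟩
      q * (q * v) * (q * (q * v))
        ≈⟨ solve 2 (λ q v → q :* (q :* v) :* (q :* (q :* v)) := q :* (q :* q :* q :* (v :* v))) refl q v ⟩
      q * (q * q * q * (v * v))        ≈⟨ *-congˡ (*-cong V-q (V-⊛ (q ^ i) (q ^ i))) ⟨
      q * (V q * V (q ^ i * q ^ i))    ≈⟨ *-congˡ (V-⊛ q (q ^ i * q ^ i)) ⟨
      q * V (q * (q ^ i * q ^ i))      ∎)) (sec₀-qV _))
    where
    v : Series
    v = V (q ^ i)
    eq : q ^ (2 ℕ.+ 3 ℕ.* i) ≈ q * (q * v)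
    eq = *-congˡ (*-congˡ (sym (V-q^ i)))

  V-1-q^ : ∀ k → V (1-q^ k) ≈ 1-q^ (3 ℕ.* k)
  V-1-q^ k = trans (V-⊕ 1# (- (q ^ k))) (+-cong V-𝟙 (trans (V-neg (q ^ k)) (-‿cong (V-q^ k))))

  hasNorm-3i : ∀ k → HasNorm (1-q^ (3 ℕ.* k)) (1-q^ k * 1-q^ k * 1-q^ k)
  hasNorm-3i k = hasNorm-cong (V-1-q^ k) refl (hasNorm-V (1-q^ k))

  -- For c = 1 and c = 2 the factors with exponent divisible by 3 make up `V (Π c m)` and have norm
  -- `Π c m` cubed, while the others are their own norms. The equation states this with the division
  -- by `V (Π c m)` cleared.
  ΠNorm : ℕ → ℕ → Set _
  ΠNorm c m = ∃ λ a → HasNorm (Π c (m ℕ.* 3)) a ∧ a * V (Π c m) ≈ Π c (m ℕ.* 3) * (Π c m * Π c m * Π c m)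

  Πnorm-step : ∀ c m {b} → let u = λ i → 1-q^ (c ℕ.+ 2 ℕ.* i) in
    HasNorm (u (m ℕ.* 3) * u (1 ℕ.+ m ℕ.* 3) * u (2 ℕ.+ m ℕ.* 3)) b →
    b * V (u m) ≈ u (m ℕ.* 3) * u (1 ℕ.+ m ℕ.* 3) * u (2 ℕ.+ m ℕ.* 3) * (u m * u m * u m) →
    ΠNorm c m → ΠNorm c (suc m)
  Πnorm-step c m {b} hb bV (a , ha , aV) = a * b ,
    hasNorm-cong (solve 4 (λ p x y z → p :* (x :* y :* z) := p :* x :* y :* z) refl _ _ _ _) refl (hasNorm-* ha hb) ,
    (begin
      a * b * V (Π c m * v)            ≈⟨ *-congˡ (V-⊛ (Π c m) v) ⟩
      a * b * (V (Π c m) * V v)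
        ≈⟨ solve 4 (λ a b x y → a :* b :* (x :* y) := a :* x :* (b :* y)) refl a b (V (Π c m)) (V v) ⟩
      a * V (Π c m) * (b * V v)        ≈⟨ *-cong aV bV ⟩
      Π c (m ℕ.* 3) * (p * p * p) * (x * y * z * (v * v * v))
        ≈⟨ solve 6 (λ r p x y z v → r :* (p :* p :* p) :* (x :* y :* z :* (v :* v :* v)) :=
             r :* x :* y :* z :* ((p :* v) :* (p :* v) :* (p :* v))) refl (Π c (m ℕ.* 3)) p x y z v ⟩
      Π c (m ℕ.* 3) * x * y * z * (p * v * (p * v) * (p * v)) ∎)
    where
    p v x y z : Series
    p = Π c m
    v = 1-q^ (c ℕ.+ 2 ℕ.* m)
    x = 1-q^ (c ℕ.+ 2 ℕ.* (m ℕ.* 3))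
    y = 1-q^ (c ℕ.+ 2 ℕ.* (1 ℕ.+ m ℕ.* 3))
    z = 1-q^ (c ℕ.+ 2 ℕ.* (2 ℕ.+ m ℕ.* 3))

  Πnorm-zero : ∀ c → ΠNorm c 0
  Πnorm-zero c = 1# * 1# * 1# , hasNorm-cong V-𝟙 refl (hasNorm-V 1#) ,
    trans (*-congˡ V-𝟙) (solve 0 (con 1 :* con 1 :* con 1 :* con 1 := con 1 :* (con 1 :* con 1 :* con 1)) refl)

  hasNorm-exp : ∀ {j k a} → j ≡ k → HasNorm (1-q^ j) a → HasNorm (1-q^ k) a
  hasNorm-exp ≡.refl h = h

  hasNorm-self : ∀ {j k} → j ≡ k → HasNorm (1-q^ j) (1-q^ j) → HasNorm (1-q^ k) (1-q^ k)
  hasNorm-self ≡.refl h = h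

  -- Of the three new factors exactly one has exponent divisible by 3, namely 3 (c + 2 m).
  Π₁-norm : ∀ m → ΠNorm 1 m
  Π₁-norm zero    = Πnorm-zero 1
  Π₁-norm (suc m) = Πnorm-step 1 m
    (hasNorm-* (hasNorm-* (hasNorm-self (e₀ m) (hasNorm-3i+1 (2 ℕ.* m)))
        (hasNorm-exp (e₁ m) (hasNorm-3i (1 ℕ.+ 2 ℕ.* m))))
      (hasNorm-self (e₂ m) (hasNorm-3i+2 (1 ℕ.+ 2 ℕ.* m))))
    (trans (*-congˡ (trans (V-1-q^ (1 ℕ.+ 2 ℕ.* m)) (reflexive (≡.cong 1-q^ (e₁ m)))))
      (solve 4 (λ x v z y → x :* (v :* v :* v) :* z :* y := x :* y :* z :* (v :* v :* v)) refl _ _ _ _))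
    (Π₁-norm m)
    where
    e₀ : ∀ m → 1 ℕ.+ 3 ℕ.* (2 ℕ.* m) ≡ 1 ℕ.+ 2 ℕ.* (m ℕ.* 3)
    e₀ = ℕ-solve
    e₁ : ∀ m → 3 ℕ.* (1 ℕ.+ 2 ℕ.* m) ≡ 1 ℕ.+ 2 ℕ.* (1 ℕ.+ m ℕ.* 3)
    e₁ = ℕ-solve
    e₂ : ∀ m → 2 ℕ.+ 3 ℕ.* (1 ℕ.+ 2 ℕ.* m) ≡ 1 ℕ.+ 2 ℕ.* (2 ℕ.+ m ℕ.* 3)
    e₂ = ℕ-solve

  Π₂-norm : ∀ m → ΠNorm 2 m
  Π₂-norm zero    = Πnorm-zero 2
  Π₂-norm (suc m) = Πnorm-step 2 m
    (hasNorm-* (hasNorm-* (hasNorm-self (e₀ m) (hasNorm-3i+2 (2 ℕ.* m)))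
        (hasNorm-self (e₁ m) (hasNorm-3i+1 (1 ℕ.+ 2 ℕ.* m))))
      (hasNorm-exp (e₂ m) (hasNorm-3i (2 ℕ.+ 2 ℕ.* m))))
    (trans (*-congˡ (trans (V-1-q^ (2 ℕ.+ 2 ℕ.* m)) (reflexive (≡.cong 1-q^ (e₂ m)))))
      (solve 4 (λ x y v z → x :* y :* (v :* v :* v) :* z := x :* y :* z :* (v :* v :* v)) refl _ _ _ _))
    (Π₂-norm m)
    where
    e₀ : ∀ m → 2 ℕ.+ 3 ℕ.* (2 ℕ.* m) ≡ 2 ℕ.+ 2 ℕ.* (m ℕ.* 3)
    e₀ = ℕ-solve
    e₁ : ∀ m → 1 ℕ.+ 3 ℕ.* (1 ℕ.+ 2 ℕ.* m) ≡ 2 ℕ.+ 2 ℕ.* (1 ℕ.+ m ℕ.* 3)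
    e₁ = ℕ-solve
    e₂ : ∀ m → 3 ℕ.* (2 ℕ.+ 2 ℕ.* m) ≡ 2 ℕ.+ 2 ℕ.* (2 ℕ.+ m ℕ.* 3)
    e₂ = ℕ-solve

-- Congruences modulo 9

-- The numbers k with 8 k + 7 = 9^b (24 n + 23).
index : ℕ → ℕ → ℕ
index zero    n = 2 ℕ.+ n ℕ.* 3
index (suc b) n = 1 ℕ.+ (2 ℕ.+ index b n ℕ.* 3) ℕ.* 3

module Congruences {c ℓ} (R : CommutativeRing c ℓ) (9≈0 : NineVanishes R) where
  private module R = CommutativeRing R
  open PowerSeries R
  open SeriesModNine R 9≈0
  open Triangular R 9≈0
  open Dissection R 9≈0
  open CommutativeRing series hiding (zero)
  open import Algebra.Properties.Ring ring using (-0#≈0#)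
  open import Relation.Binary.Reasoning.Setoid setoid
  open SolverModNine series 9≋0 using (solve; _:+_; _:*_; _:-_; :-_; _:=_)

  Π₀≈1 : ∀ c m → Π (suc c) m 0 R.≈ R.1#
  Π₀≈1 c zero    = R.refl
  Π₀≈1 c (suc m) = R.trans (R.*-cong (Π₀≈1 c m) (1-q^suc₀≈1 (c ℕ.+ 2 ℕ.* m))) (R.*-identityˡ _)

  sec₀-trunc : ∀ {m f g} → f ≋[ suc (2 ℕ.* (m ℕ.* 3)) ] g → sec 0 f ≋[ suc m ] sec 0 g
  sec₀-trunc {m} p n (s≤s n≤m) = p (n ℕ.* 3) (s≤s (ℕₚ.≤-trans (ℕₚ.*-monoˡ-≤ 3 n≤m) (ℕₚ.m≤m+n (m ℕ.* 3) _)))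

  module _ (φΠ₁≋Π₂ : ∀ m → φ * Π 1 m ≋[ suc (2 ℕ.* m) ] Π 2 m) where

    -- The norm of φ = ∏ (1 - q^(2j)) / (1 - q^(2j-1)) can be taken factor by factor, up to any given order.
    Eφ₃≈φ⁴ : E * φ₃ ≈ φ * φ * φ * φ
    Eφ₃≈φ⁴ = pointwise λ n → truncated n n ℕₚ.≤-refl
      where
      truncated : ∀ m → E * φ₃ ≋[ suc m ] φ * φ * φ * φ
      truncated m with Π₁-norm m | Π₂-norm m
      ... | a , ha , aV | b , hb , bV = ⊛-cancel-trunc D (suc m) D₀≈1
        (trunc-trans (≋⇒trunc lhs) (trunc-trans middle (≋⇒trunc rhs)))
        where
        x p₁ p₂ D : Series
        x = φ * Π 1 (m ℕ.* 3)
        p₁ = Π 1 m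
        p₂ = Π 2 m
        -- By `aV` this equals `a * V p₁`. It clears all denominators at once and has constant term
        -- 1, so it can be cancelled.
        D = Π 1 (m ℕ.* 3) * (p₁ * p₁ * p₁)
        D₀≈1 : D 0 R.≈ R.1#
        D₀≈1 = R.trans (R.*-cong (Π₀≈1 0 (m ℕ.* 3)) (R.trans (R.*-cong (R.trans (R.*-cong (Π₀≈1 0 m) (Π₀≈1 0 m))
          (R.*-identityˡ _)) (Π₀≈1 0 m)) (R.*-identityˡ _))) (R.*-identityˡ _)
        m<1+2m : suc m ≤ suc (2 ℕ.* m)
        m<1+2m = s≤s (ℕₚ.m≤m+n m _)
        m≤3m : suc m ≤ suc (2 ℕ.* (m ℕ.* 3))
        m≤3m = s≤s (ℕₚ.≤-trans (ℕₚ.m≤m*n m 3) (ℕₚ.m≤m+n (m ℕ.* 3) _))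
        φp₁≋p₂ : φ * p₁ ≋[ suc m ] p₂
        φp₁≋p₂ = trunc-≤ m<1+2m (φΠ₁≋Π₂ m)
        x≋Π₂ : x ≋[ suc (2 ℕ.* (m ℕ.* 3)) ] Π 2 (m ℕ.* 3)
        x≋Π₂ = φΠ₁≋Π₂ (m ℕ.* 3)
        -- Both sides are norms, of `x` and of `Π 2 (m * 3)`. Read off as sections of cubes, they
        -- inherit the agreement of these two series.
        Ea≋b : E * a ≋[ suc m ] b
        Ea≋b = trunc-trans (≋⇒trunc (sym (HasNorm⇒sec₀ {f = x} (hasNorm-* {f = φ} hasNorm-φ ha))))
          (trunc-trans (sec₀-trunc (⊛-cong-trunc {f = x * x} (⊛-cong-trunc {f = x} x≋Π₂ x≋Π₂) x≋Π₂))
            (≋⇒trunc (HasNorm⇒sec₀ {f = Π 2 (m ℕ.* 3)} hb)))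
        lhs : D * (E * φ₃) ≈ E * a * V (φ * p₁)
        lhs = begin
          D * (E * φ₃)            ≈⟨ *-congʳ aV ⟨
          a * V p₁ * (E * φ₃)
            ≈⟨ solve 4 (λ a v e f → a :* v :* (e :* f) := e :* a :* (f :* v)) refl a (V p₁) E φ₃ ⟩
          E * a * (φ₃ * V p₁)     ≈⟨ *-congˡ (V-⊛ φ p₁) ⟨
          E * a * V (φ * p₁)      ∎
        V-trunc : V (φ * p₁) ≋[ suc m ] V p₂
        V-trunc n n<m = V-cong-≤ n λ i i≤n → φp₁≋p₂ i (ℕₚ.≤-<-trans i≤n n<m)
        middle : E * a * V (φ * p₁) ≋[ suc m ] x * (φ * p₁ * (φ * p₁) * (φ * p₁))
        middle = trunc-trans (⊛-cong-trunc {f = E * a} Ea≋b V-trunc) (trunc-trans (≋⇒trunc bV) (trunc-sym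
          (⊛-cong-trunc {f = x} (trunc-≤ m≤3m x≋Π₂)
            (⊛-cong-trunc {f = φ * p₁ * (φ * p₁)} (⊛-cong-trunc {f = φ * p₁} φp₁≋p₂ φp₁≋p₂) φp₁≋p₂))))
        rhs : x * (φ * p₁ * (φ * p₁) * (φ * p₁)) ≈ D * (φ * φ * φ * φ)
        rhs = solve 3 (λ f r p → f :* r :* (f :* p :* (f :* p) :* (f :* p)) := r :* (p :* p :* p) :* (f :* f :* f :* f))
          refl φ (Π 1 (m ℕ.* 3)) p₁

    module _ (P : Series) (φP≈1 : φ * P ≈ 1#) where

      cube : Series → Series
      cube f = f * f * f

      cube-cong : ∀ {f g} → f ≈ g → cube f ≈ cube g
      cube-cong p = *-cong (*-cong p p) p

      cube-* : ∀ f g → cube f * cube g ≈ cube (f * g)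
      cube-* = solve 2 (λ f g → f :* f :* f :* (g :* g :* g) := f :* g :* (f :* g) :* (f :* g)) refl

      -- The cube of φ is `V E` plus a multiple of 3, and cubing again turns that multiple into
      -- multiples of 9.
      φ⁹≈VE³ : cube (cube φ) ≈ V (cube E)
      φ⁹≈VE³ = begin
        cube (cube φ)                  ≈⟨ cube-cong (proj₁ (proj₂ hasNorm-φ)) ⟩
        cube (V E + (h + h + h))
          ≈⟨ solve 2 (λ e h → (e :+ (h :+ h :+ h)) :* (e :+ (h :+ h :+ h)) :* (e :+ (h :+ h :+ h)) := e :* e :* e)
               refl (V E) h ⟩
        cube (V E)                     ≈⟨ V-cube E ⟨
        V (cube E)                     ∎
        where
        h : Series
        h = proj₁ hasNorm-φ

      -- Descent: at a positive degree a coefficient of `V f` is either zero or the coefficient of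
      -- `f` at a third of that degree.
      V-fixed : ∀ {f} → f ≈ V f → f 0 R.≈ R.1# → f ≈ 1#
      V-fixed {f} fixed f₀ = pointwise λ n → below n n ℕₚ.≤-refl
        where
        below : ∀ k n → n ≤ k → f n R.≈ 1# n
        below k       zero    _         = f₀
        below (suc k) (suc n) (s≤s n≤k) = R.trans (at fixed (suc n)) (shrink n n≤k)
          where
          shrink : ∀ n → n ≤ k → V f (suc n) R.≈ R.0#
          shrink zero          _ = R.refl
          shrink (suc zero)    _ = R.refl
          shrink (suc (suc n)) p = R.trans
            (V-cong-≤ {g = 0#} n λ i i≤n → below k (suc i) (ℕₚ.≤-trans (s≤s i≤n) (ℕₚ.≤-trans (ℕₚ.n≤1+n _) p)))
            (at V-𝟘 n)

      VφVP≈1 : φ₃ * V P ≈ 1#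
      VφVP≈1 = trans (sym (V-⊛ φ P)) (trans (V-cong φP≈1) V-𝟙)

      φ³P≈φ² : cube φ * P ≈ φ * φ
      φ³P≈φ² = begin
        φ * φ * φ * P    ≈⟨ *-assoc (φ * φ) φ P ⟩
        φ * φ * (φ * P)  ≈⟨ *-congˡ φP≈1 ⟩
        φ * φ * 1#       ≈⟨ *-identityʳ _ ⟩
        φ * φ            ∎

      φ⁹P³≈φ⁶ : cube (cube φ) * cube P ≈ cube (φ * φ)
      φ⁹P³≈φ⁶ = trans (cube-* (cube φ) P) (cube-cong φ³P≈φ²)

      -- The norm formula divided by φ φ₃, with `P` and `V P` as the inverses.
      EP≈φ³VP : E * P ≈ cube φ * V P
      EP≈φ³VP = begin
        E * P                      ≈⟨ *-identityʳ _ ⟨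
        E * P * 1#                 ≈⟨ *-congˡ VφVP≈1 ⟨
        E * P * (φ₃ * V P)         ≈⟨ solve 4 (λ e p f v → e :* p :* (f :* v) := e :* f :* p :* v) refl E P φ₃ (V P) ⟩
        E * φ₃ * P * V P           ≈⟨ *-congʳ (*-congʳ Eφ₃≈φ⁴) ⟩
        φ * φ * φ * φ * P * V P    ≈⟨ *-congʳ (trans (*-assoc (cube φ) φ P) (trans (*-congˡ φP≈1) (*-identityʳ _))) ⟩
        cube φ * V P               ∎

      -- The quotient φ^9 / φ(q^3)^3 is invariant under q ↦ q^3.
      φ⁹≈φ₃³ : cube (cube φ) ≈ cube φ₃
      φ⁹≈φ₃³ = begin
        cube (cube φ)                        ≈⟨ *-identityʳ _ ⟨
        cube (cube φ) * 1#                   ≈⟨ *-congˡ VP³φ₃³≈1 ⟨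
        cube (cube φ) * (cube (V P) * cube φ₃)  ≈⟨ *-assoc (cube (cube φ)) (cube (V P)) (cube φ₃) ⟨
        r * cube φ₃                          ≈⟨ *-congʳ (V-fixed r≈Vr r₀≈1) ⟩
        1# * cube φ₃                         ≈⟨ *-identityˡ _ ⟩
        cube φ₃                              ∎
        where
        r : Series
        r = cube (cube φ) * cube (V P)
        VP³φ₃³≈1 : cube (V P) * cube φ₃ ≈ 1#
        VP³φ₃³≈1 = trans (cube-* (V P) φ₃) (trans (cube-cong (trans (*-comm (V P) φ₃) VφVP≈1))
          (trans (*-congʳ (*-identityˡ 1#)) (*-identityˡ 1#)))
        φ0≈1 : φ 0 R.≈ R.1#
        φ0≈1 = R.+-identityˡ _
        1*1 : ∀ {a b} → a R.≈ R.1# → b R.≈ R.1# → a R.* b R.≈ R.1#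
        1*1 p p′ = R.trans (R.*-cong p p′) (R.*-identityˡ _)
        φ²0≈1 : (φ * φ) 0 R.≈ R.1#
        φ²0≈1 = 1*1 φ0≈1 φ0≈1
        r₀≈1 : r 0 R.≈ R.1#
        -- `V P` and `P` have the same constant term, so the equation for φ^9 P^3 applies at degree
        -- 0.
        r₀≈1 = R.trans (at φ⁹P³≈φ⁶ 0) (1*1 (1*1 φ²0≈1 φ²0≈1) φ²0≈1)
        r≈Vr : r ≈ V r
        r≈Vr = begin
          cube (cube φ) * cube (V P)   ≈⟨ *-congʳ φ⁹≈VE³ ⟩
          V (cube E) * cube (V P)      ≈⟨ *-congˡ (V-cube P) ⟨
          V (cube E) * V (cube P)      ≈⟨ V-⊛ (cube E) (cube P) ⟨
          V (cube E * cube P)          ≈⟨ V-cong (trans (cube-* E P) (trans (cube-cong EP≈φ³VP) (sym (cube-* (cube φ) (V P))))) ⟩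
          V r                          ∎

      φ₃³P³≈φ⁶ : cube φ₃ * cube P ≈ cube (φ * φ)
      φ₃³P³≈φ⁶ = trans (*-congʳ (sym φ⁹≈φ₃³)) φ⁹P³≈φ⁶

      G₀ : Series
      G₀ = sec 0 (cube P)

      -- Under the section the factor becomes φ₃^3, which turns P^3 into φ^6. This is the cube of
      -- φ^2, so its section is the norm of φ^2.
      φ³G₀≈E² : cube φ * G₀ ≈ E * E
      φ³G₀≈E² = begin
        cube φ * G₀                     ≈⟨ secV⊛₀ (cube φ) (cube P) ⟨
        sec 0 (V (cube φ) * cube P)     ≈⟨ sec-cong 0 (*-congʳ (V-cube φ)) ⟩
        sec 0 (cube φ₃ * cube P)        ≈⟨ sec-cong 0 φ₃³P³≈φ⁶ ⟩
        sec 0 (cube (φ * φ))            ≈⟨ HasNorm⇒sec₀ {f = φ * φ} (hasNorm-* {f = φ} {g = φ} hasNorm-φ hasNorm-φ) ⟩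
        E * E                           ∎

      cancel-φ : ∀ {f g} → φ * f ≈ φ * g → f ≈ g
      cancel-φ {f} {g} eq = begin
        f            ≈⟨ one f ⟨
        P * (φ * f)  ≈⟨ *-congˡ eq ⟩
        P * (φ * g)  ≈⟨ one g ⟩
        g            ∎
        where
        one : ∀ f → P * (φ * f) ≈ f
        one f = trans (solve 3 (λ p x f → p :* (x :* f) := x :* p :* f) refl P φ f) (trans (*-congʳ φP≈1) (*-identityˡ f))

      -- Squaring the norm formula turns φ₃^2 E^2 into φ^8, from which φ^3 is cancelled.
      φ₃²G₀≈φ⁵ : φ₃ * φ₃ * G₀ ≈ φ * φ * φ * φ * φ
      φ₃²G₀≈φ⁵ = cancel-φ (cancel-φ (cancel-φ (begin
        φ * (φ * (φ * (φ₃ * φ₃ * G₀)))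
          ≈⟨ solve 3 (λ f f₃ g → f :* (f :* (f :* (f₃ :* f₃ :* g))) := f₃ :* f₃ :* (f :* f :* f :* g)) refl φ φ₃ G₀ ⟩
        φ₃ * φ₃ * (cube φ * G₀)            ≈⟨ *-congˡ φ³G₀≈E² ⟩
        φ₃ * φ₃ * (E * E)                  ≈⟨ solve 2 (λ f e → f :* f :* (e :* e) := e :* f :* (e :* f)) refl φ₃ E ⟩
        E * φ₃ * (E * φ₃)                  ≈⟨ *-cong Eφ₃≈φ⁴ Eφ₃≈φ⁴ ⟩
        φ * φ * φ * φ * (φ * φ * φ * φ)
          ≈⟨ solve 1 (λ f → f :* f :* f :* f :* (f :* f :* f :* f) := f :* (f :* (f :* (f :* f :* f :* f :* f)))) refl φ ⟩
        φ * (φ * (φ * (φ * φ * φ * φ * φ)))  ∎)))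

      V-E : V E ≈ V A * V A * V A + q * V φ₃ * (q * V φ₃) * (q * V φ₃)
      V-E = begin
        V (A * A * A + q * (φ₃ * φ₃ * φ₃))       ≈⟨ V-⊕ (A * A * A) (q * (φ₃ * φ₃ * φ₃)) ⟩
        V (A * A * A) + V (q * (φ₃ * φ₃ * φ₃))
          ≈⟨ +-cong (V-cube A) (trans (V-⊛ q (φ₃ * φ₃ * φ₃)) (*-cong V-q (V-cube φ₃))) ⟩
        V A * V A * V A + q * q * q * (V φ₃ * V φ₃ * V φ₃)
          ≈⟨ +-congˡ (solve 2 (λ q v → q :* q :* q :* (v :* v :* v) := q :* v :* (q :* v) :* (q :* v)) refl q (V φ₃)) ⟩
        V A * V A * V A + q * V φ₃ * (q * V φ₃) * (q * V φ₃) ∎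

      φ²-dissection : φ * φ ≈ V (A * A) + q * V (A * φ₃ + A * φ₃) + q²V (φ₃ * φ₃)
      φ²-dissection = begin
        φ * φ                                  ≈⟨ *-cong φ-dissection φ-dissection ⟩
        (a + q * b) * (a + q * b)
          ≈⟨ solve 3 (λ a b q → (a :+ q :* b) :* (a :+ q :* b) :=
               a :* a :+ q :* (a :* b :+ a :* b) :+ q :* (q :* (b :* b))) refl a b q ⟩
        a * a + q * (a * b + a * b) + q * (q * (b * b))
          ≈⟨ +-cong (+-cong (V-⊛ A A) (*-congˡ (trans (V-⊕ _ _) (+-cong (V-⊛ A φ₃) (V-⊛ A φ₃)))))
               (*-congˡ (*-congˡ (V-⊛ φ₃ φ₃))) ⟨
        V (A * A) + q * V (A * φ₃ + A * φ₃) + q²V (φ₃ * φ₃) ∎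
        where
        a b : Series
        a = V A
        b = V φ₃

      sec₂-φ² : sec 2 (φ * φ) ≈ φ₃ * φ₃
      sec₂-φ² = trans (sec-cong 2 φ²-dissection) (sec₂-sum _ _ _)

      -- Modulo 9, (a + y)^5 = (a^2 + 5 a y + y^2) (a^3 + y^3), because 10 = 1.
      φ⁵-dissection : φ * φ * φ * φ * φ ≈
        V (A * A * E) + q * V (φ₃ * (A + A + A + A + A) * E) + q²V (φ₃ * φ₃ * E)
      φ⁵-dissection = begin
        φ * φ * φ * φ * φ
          ≈⟨ *-cong (*-cong (*-cong (*-cong φ-dissection φ-dissection) φ-dissection) φ-dissection) φ-dissection ⟩
        (a + y) * (a + y) * (a + y) * (a + y) * (a + y)
          ≈⟨ solve 2 (λ a y → (a :+ y) :* (a :+ y) :* (a :+ y) :* (a :+ y) :* (a :+ y) :=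
               (a :* a :+ y :* (a :+ a :+ a :+ a :+ a) :+ y :* y) :* (a :* a :* a :+ y :* y :* y)) refl a y ⟩
        (a * a + y * (a + a + a + a + a) + y * y) * (a * a * a + y * y * y)
          ≈⟨ *-cong (+-congʳ (+-congˡ (*-congˡ V-5A))) V-E ⟨
        (a * a + y * V A₅ + y * y) * V E
          ≈⟨ solve 5 (λ a b c e q → (a :* a :+ q :* b :* c :+ q :* b :* (q :* b)) :* e :=
               a :* a :* e :+ q :* (b :* c :* e) :+ q :* (q :* (b :* b :* e))) refl a b (V A₅) (V E) q ⟩
        a * a * V E + q * (b * V A₅ * V E) + q * (q * (b * b * V E))
          ≈⟨ +-cong (+-cong (V-mul₃ A A E) (*-congˡ (V-mul₃ φ₃ A₅ E))) (*-congˡ (*-congˡ (V-mul₃ φ₃ φ₃ E))) ⟨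
        V (A * A * E) + q * V (φ₃ * A₅ * E) + q²V (φ₃ * φ₃ * E) ∎
        where
        a b y A₅ : Series
        a  = V A
        b  = V φ₃
        y  = q * b
        A₅ = A + A + A + A + A
        V-mul₃ : ∀ f g h → V (f * g * h) ≈ V f * V g * V h
        V-mul₃ f g h = trans (V-⊛ (f * g) h) (*-congʳ (V-⊛ f g))
        V-5A : V A₅ ≈ a + a + a + a + a
        V-5A = trans (V-⊕ (A + A + A + A) A) (+-congʳ (trans (V-⊕ (A + A + A) A)
          (+-congʳ (trans (V-⊕ (A + A) A) (+-congʳ (V-⊕ A A))))))

      sec₂-φ⁵ : sec 2 (φ * φ * φ * φ * φ) ≈ φ₃ * φ₃ * E
      sec₂-φ⁵ = trans (sec-cong 2 φ⁵-dissection) (sec₂-sum _ _ _)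

      cancel-φ₃ : ∀ {f g} → φ₃ * f ≈ φ₃ * g → f ≈ g
      cancel-φ₃ {f} {g} eq = begin
        f              ≈⟨ one f ⟨
        V P * (φ₃ * f)  ≈⟨ *-congˡ eq ⟩
        V P * (φ₃ * g)  ≈⟨ one g ⟩
        g              ∎
        where
        one : ∀ f → V P * (φ₃ * f) ≈ f
        one f = trans (solve 3 (λ p x f → p :* (x :* f) := x :* p :* f) refl (V P) φ₃ f)
          (trans (*-congʳ VφVP≈1) (*-identityˡ f))

      φ²G₀₂≈φ₃²E : φ * φ * sec 2 G₀ ≈ φ₃ * φ₃ * E
      φ²G₀₂≈φ₃²E = begin
        φ * φ * sec 2 G₀             ≈⟨ secV⊛₂ (φ * φ) G₀ ⟨
        sec 2 (V (φ * φ) * G₀)       ≈⟨ sec-cong 2 (*-congʳ (V-⊛ φ φ)) ⟩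
        sec 2 (φ₃ * φ₃ * G₀)         ≈⟨ sec-cong 2 φ₃²G₀≈φ⁵ ⟩
        sec 2 (φ * φ * φ * φ * φ)    ≈⟨ sec₂-φ⁵ ⟩
        φ₃ * φ₃ * E                  ∎

      G₀₂≈φ₃φ² : sec 2 G₀ ≈ φ₃ * (φ * φ)
      G₀₂≈φ₃φ² = cancel-φ₃ (cancel-φ (cancel-φ (begin
        φ * (φ * (φ₃ * sec 2 G₀))
          ≈⟨ solve 3 (λ f f₃ g → f :* (f :* (f₃ :* g)) := f₃ :* (f :* f :* g)) refl φ φ₃ (sec 2 G₀) ⟩
        φ₃ * (φ * φ * sec 2 G₀)            ≈⟨ *-congˡ φ²G₀₂≈φ₃²E ⟩
        φ₃ * (φ₃ * φ₃ * E)                 ≈⟨ solve 2 (λ f e → f :* (f :* f :* e) := f :* f :* (e :* f)) refl φ₃ E ⟩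
        φ₃ * φ₃ * (E * φ₃)                 ≈⟨ *-congˡ Eφ₃≈φ⁴ ⟩
        φ₃ * φ₃ * (φ * φ * φ * φ)
          ≈⟨ solve 2 (λ f f₃ → f₃ :* f₃ :* (f :* f :* f :* f) := f :* (f :* (f₃ :* (f₃ :* (f :* f))))) refl φ φ₃ ⟩
        φ * (φ * (φ₃ * (φ₃ * (φ * φ))))    ∎)))

      -- The exponents k here have the form T(a) + 3 T(b) + 3 T(c), so 8 k + 7 = x^2 + 3 y^2 + 3 z^2
      -- with x, y, z odd. This explains the 7 in `index`.
      D : Series
      D = φ * (φ₃ * φ₃)

      G₀₂₂≈D : sec 2 (sec 2 G₀) ≈ D
      G₀₂₂≈D = begin
        sec 2 (sec 2 G₀)        ≈⟨ sec-cong 2 G₀₂≈φ₃φ² ⟩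
        sec 2 (V φ * (φ * φ))   ≈⟨ secV⊛₂ φ (φ * φ) ⟩
        φ * sec 2 (φ * φ)       ≈⟨ *-congˡ sec₂-φ² ⟩
        φ * (φ₃ * φ₃)           ∎

      D≈Vφ²φ : D ≈ V (φ * φ) * φ
      D≈Vφ²φ = trans (*-comm φ (φ₃ * φ₃)) (*-congʳ (sym (V-⊛ φ φ)))

      sec₂-D : sec 2 D ≈ 0#
      sec₂-D = begin
        sec 2 D                   ≈⟨ sec-cong 2 D≈Vφ²φ ⟩
        sec 2 (V (φ * φ) * φ)     ≈⟨ secV⊛₂ (φ * φ) φ ⟩
        φ * φ * sec 2 φ           ≈⟨ *-congˡ sec₂-φ ⟩
        φ * φ * 0#                ≈⟨ zeroʳ (φ * φ) ⟩
        0#                        ∎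

      sec₂-sec₁-D : sec 2 (sec 1 D) ≈ - D
      sec₂-sec₁-D = begin
        sec 2 (sec 1 D)                  ≈⟨ sec-cong 2 (trans (sec-cong 1 D≈Vφ²φ) (secV⊛₁ (φ * φ) φ)) ⟩
        sec 2 (φ * φ * sec 1 φ)          ≈⟨ sec-cong 2 (*-congˡ {φ * φ} sec₁-φ) ⟩
        sec 2 (φ * φ * - V φ)            ≈⟨ sec-cong 2 (solve 2 (λ f v → f :* :- v := :- (v :* f)) refl (φ * φ) (V φ)) ⟩
        - sec 2 (V φ * (φ * φ))          ≈⟨ -‿cong (trans (secV⊛₂ φ (φ * φ)) (*-congˡ sec₂-φ²)) ⟩
        - (φ * (φ₃ * φ₃))                ∎

      D-vanishes : ∀ b n → D (index b n) R.≈ R.0#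
      D-vanishes zero    n = at sec₂-D n
      D-vanishes (suc b) n = R.trans (at sec₂-sec₁-D (index b n))
        (R.trans (R.-‿cong (D-vanishes b n)) (at -0#≈0# 0))

      P³-vanishes : ∀ b n → (P * P * P) ((2 ℕ.+ (2 ℕ.+ index b n ℕ.* 3) ℕ.* 3) ℕ.* 3) R.≈ R.0#
      P³-vanishes b n = R.trans (at G₀₂₂≈D (index b n)) (D-vanishes b n)

-- Counting partitions

open import Defs
open import Data.Empty using (⊥-elim)
open import Data.List using (List; []; _∷_; _++_; map; length; filter; cartesianProduct)
open import Data.List.Membership.Propositional using (_∈_; _∉_)
open import Data.List.Membership.Propositional.Properties
  using (∈-filter⁺; ∈-filter⁻; ∈-cartesianProduct⁺; ∈-cartesianProduct⁻; ∈-++⁺ˡ; ∈-++⁺ʳ; ∈-++⁻; ∈-map⁺; ∈-map⁻)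
open import Data.List.Membership.Propositional.Properties.WithK using (unique∧set⇒bag)
open import Data.List.Properties using (length-++; length-map; filter-accept; filter-reject; ∷-injectiveʳ)
open import Data.List.Relation.Binary.BagAndSetEquality using (∼bag⇒↭)
open import Data.List.Relation.Binary.Permutation.Propositional.Properties using (↭-length)
open import Data.List.Relation.Unary.All as All using (All; []; _∷_; all?)
open import Data.List.Relation.Unary.AllPairs using ([]; _∷_)
open import Data.List.Relation.Unary.Any using (here)
open import Data.List.Relation.Unary.Linked as Linked using (Linked; []; [-]; _∷_)
open import Data.List.Relation.Unary.Linked.Properties using (Linked⇒All)
open import Data.List.Relation.Unary.Unique.Propositional using (Unique)
open import Data.List.Relation.Unary.Unique.Propositional.Properties using (map⁺; ++⁺; filter⁺; cartesianProduct⁺)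
open import Data.Nat using (_+_; _*_; _^_; _≥_; _≟_; _≤?_; s≤s⁻¹)
open import Data.Nat.Divisibility using (_∣_; m%n≡0⇒n∣m; ∣m+n∣m⇒∣n; >⇒∤; m∣m*n)
open import Data.Nat.DivMod using (%-distribˡ-+; %-distribˡ-*; m*n/n≡m)
open import Data.Nat.ListAction using (sum)
open import Data.Nat.Properties
open import Data.Product using (_×_)
open import Data.Sum using (inj₁; inj₂)
open import Function using (mk⇔; Equivalence)
open import Relation.Binary.PropositionalEquality using (refl; sym; trans; cong; cong₂; subst)
open import Relation.Nullary.Decidable using (_×-dec_)
open import Relation.Unary using (Decidable)

-- Duplicate-free lists with the same members are permutations of each other. All counting
-- identities below are reduced to membership through this.
unique-length : ∀ {a} {A : Set a} {xs ys : List A} → Unique xs → Unique ys →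
                (∀ x → x ∈ xs → x ∈ ys) → (∀ x → x ∈ ys → x ∈ xs) → length xs ≡ length ys
unique-length u v f g = ↭-length (∼bag⇒↭ (unique∧set⇒bag u v (mk⇔ (f _) (g _))))

isPOD-[] : IsPOD []
isPOD-[] = ([] , []) , []

-- Distinctness inside the filtered list becomes a condition on the largest part alone, the form in
-- which that part can be removed or put back.
isPOD-∷⁻ : ∀ {p ps} → IsPOD (p ∷ ps) → IsPOD ps × 1 ≤ p × All (_≤ p) ps × (Odd p → p ∉ ps)
isPOD-∷⁻ {p} {ps} ((linked , 1≤p ∷ pos) , distinct) = go (odd? p)
  where
  ps≤p : All (_≤ p) ps
  ps≤p = All.tail (Linked⇒All (λ a b → ≤-trans b a) ≤-refl linked)
  go : Dec (Odd p) → IsPOD ps × 1 ≤ p × All (_≤ p) ps × (Odd p → p ∉ ps)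
  go (yes o) with subst Unique (filter-accept odd? o) distinct
  ... | p≢ ∷ d = ((Linked.tail linked , pos) , d) , 1≤p , ps≤p ,
    λ _ p∈ps → All.lookup p≢ (∈-filter⁺ odd? p∈ps o) refl
  go (no ¬o) = ((Linked.tail linked , pos) , subst Unique (filter-reject odd? ¬o) distinct) , 1≤p , ps≤p ,
    λ o → ⊥-elim (¬o o)

isPOD-∷⁺ : ∀ {p ps} → IsPOD ps → 1 ≤ p → All (_≤ p) ps → (Odd p → p ∉ ps) → IsPOD (p ∷ ps)
isPOD-∷⁺ {p} {ps} ((linked , pos) , d) 1≤p ps≤p p∉ = (link linked ps≤p , 1≤p ∷ pos) , distinct (odd? p)
  where
  link : ∀ {ps} → Linked _≥_ ps → All (_≤ p) ps → Linked _≥_ (p ∷ ps)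
  link []       []       = [-]
  link [-]      (q ∷ _)  = q ∷ [-]
  link (r ∷ l)  (q ∷ _)  = q ∷ r ∷ l
  distinct : Dec (Odd p) → Unique (filter odd? (p ∷ ps))
  distinct (no ¬o) = subst Unique (sym (filter-reject odd? ¬o)) d
  distinct (yes o) = subst Unique (sym (filter-accept odd? o))
    (All.tabulate (λ x∈ p≡x → p∉ o (subst (_∈ ps) (sym p≡x) (proj₁ (∈-filter⁻ odd? {xs = ps} x∈)))) ∷ d)

PODBelow : ℕ → ℕ → List ℕ → Set
PODBelow m n ps = IsPOD ps × All (_≤ m) ps × sum ps ≡ n

podBelow? : ∀ m n → Decidable (PODBelow m n)
podBelow? m n ps = isPOD? ps ×-dec all? (_≤? m) ps ×-dec (sum ps ≟ n)

abstract
  pods : ℕ → ℕ → List (List ℕ)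
  pods m n = filter (podBelow? m n) (boundedLists n n)

  pods-unique : ∀ m n → Unique (pods m n)
  pods-unique m n = filter⁺ (podBelow? m n) (boundedLists-unique n n)

  ∈-pods⁺ : ∀ {m n ps} → PODBelow m n ps → ps ∈ pods m n
  ∈-pods⁺ {m} {n} p@(((_ , pos) , _) , _ , s) = ∈-filter⁺ (podBelow? m n)
    (∈-boundedLists n n pos (≤-reflexive s) (≤-reflexive s)) p

  ∈-pods⁻ : ∀ {m n ps} → ps ∈ pods m n → PODBelow m n ps
  ∈-pods⁻ {m} {n} p = proj₂ (∈-filter⁻ (podBelow? m n) {xs = boundedLists n n} p)

count : ℕ → ℕ → ℕ
count m n = length (pods m n)

count-0-0 : count 0 0 ≡ 1
count-0-0 = unique-length (pods-unique 0 0) ([] ∷ []) to λ { _ (here refl) → ∈-pods⁺ (isPOD-[] , [] , refl) }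
  where
  to : ∀ ps → ps ∈ pods 0 0 → ps ∈ [] ∷ []
  to []       _  = here refl
  to (p ∷ ps) ∈₀ with ∈-pods⁻ {0} {0} ∈₀
  ... | ((_ , 1≤p ∷ _) , _) , p≤0 ∷ _ , _ = ⊥-elim (1+n≰n (≤-trans 1≤p p≤0))

count-0-suc : ∀ n → count 0 (suc n) ≡ 0
count-0-suc n = unique-length (pods-unique 0 (suc n)) [] (λ ps ps∈ → ⊥-elim (none ps (∈-pods⁻ ps∈))) (λ _ ())
  where
  none : ∀ ps → ¬ PODBelow 0 (suc n) ps
  none []       (_ , _ , ())
  none (p ∷ ps) (((_ , 1≤p ∷ _) , _) , p≤0 ∷ _ , _) = 1+n≰n (≤-trans 1≤p p≤0)

parts≤sum : ∀ ps → All (_≤ sum ps) ps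
parts≤sum []       = []
parts≤sum (p ∷ ps) = m≤m+n p (sum ps) ∷ All.map (λ x≤ → ≤-trans x≤ (m≤n+m (sum ps) p)) (parts≤sum ps)

-- No part exceeds the sum, so a bound at or above the sum does not restrict anything.
count-saturated : ∀ {m n} → n ≤ m → count m n ≡ count n n
count-saturated {m} {n} n≤m = unique-length (pods-unique m n) (pods-unique n n)
  (λ ps ps∈ → let (pod , _ , s) = ∈-pods⁻ {m} ps∈ in
    ∈-pods⁺ (pod , subst (λ n → All (_≤ n) ps) s (parts≤sum ps) , s))
  (λ ps ps∈ → let (pod , b , s) = ∈-pods⁻ {n} ps∈ in ∈-pods⁺ (pod , All.map (λ x≤n → ≤-trans x≤n n≤m) b , s))

head≤⇒All≤ : ∀ {m p ps} → p ≤ m → IsPOD (p ∷ ps) → All (_≤ m) (p ∷ ps)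
head≤⇒All≤ p≤m pod = p≤m ∷ All.map (λ x≤p → ≤-trans x≤p p≤m) (proj₁ (proj₂ (proj₂ (isPOD-∷⁻ pod))))

count-below : ∀ {k n} → n ≤ k → count (suc k) n ≡ count k n
count-below n≤k = trans (count-saturated (m≤n⇒m≤1+n n≤k)) (sym (count-saturated n≤k))

-- After a part k + 1 has been removed the remaining parts are at most k if k + 1 is odd and at most k + 1 otherwise.
count-suc : ∀ k k′ → (∀ {qs} → All (_≤ suc k) qs → (Odd (suc k) → suc k ∉ qs) → All (_≤ k′) qs) →
            (∀ {qs} → All (_≤ k′) qs → All (_≤ suc k) qs × (Odd (suc k) → suc k ∉ qs)) →
            ∀ i → count (suc k) (suc k + i) ≡ count k (suc k + i) + count k′ i
count-suc k k′ restrict extend i = trans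
  (unique-length (pods-unique (suc k) n)
    (++⁺ (pods-unique k n) (map⁺ ∷-injectiveʳ (pods-unique k′ i)) disjoint) (λ ps ps∈ → split ps (∈-pods⁻ ps∈)) join)
  (trans (length-++ (pods k n)) (cong (count k n +_) (length-map (suc k ∷_) (pods k′ i))))
  where
  n : ℕ
  n = suc k + i
  disjoint : ∀ {ps} → ps ∈ pods k n × ps ∈ map (suc k ∷_) (pods k′ i) → _
  disjoint (∈₁ , ∈₂) with ∈-map⁻ (suc k ∷_) ∈₂
  ... | _ , _ , refl with proj₁ (proj₂ (∈-pods⁻ {k} ∈₁))
  ...   | 1+k≤k ∷ _ = 1+n≰n 1+k≤k
  split : ∀ ps → PODBelow (suc k) n ps → ps ∈ pods k n ++ map (suc k ∷_) (pods k′ i)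
  split []       (_ , _ , ())
  split (p ∷ qs) (pod , p≤ ∷ qs≤ , s) with m≤n⇒m<n∨m≡n p≤
  ... | inj₁ (s≤s p≤k) = ∈-++⁺ˡ (∈-pods⁺ (pod , head≤⇒All≤ p≤k pod , s))
  ... | inj₂ refl = ∈-++⁺ʳ (pods k n) (∈-map⁺ (suc k ∷_) (∈-pods⁺
          (proj₁ (isPOD-∷⁻ pod) , restrict qs≤ (proj₂ (proj₂ (proj₂ (isPOD-∷⁻ pod)))) , +-cancelˡ-≡ (suc k) _ _ s)))
  join : ∀ ps → ps ∈ pods k n ++ map (suc k ∷_) (pods k′ i) → ps ∈ pods (suc k) n
  join ps ps∈ with ∈-++⁻ (pods k n) ps∈
  ... | inj₁ ∈₁ = let (pod , b , s) = ∈-pods⁻ {k} ∈₁ in ∈-pods⁺ (pod , All.map m≤n⇒m≤1+n b , s)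
  ... | inj₂ ∈₂ with ∈-map⁻ (suc k ∷_) ∈₂
  ...   | qs , qs∈ , refl = let
            (pod , b , s) = ∈-pods⁻ {k′} qs∈
            (b′ , k∉) = extend b
          in ∈-pods⁺ (isPOD-∷⁺ pod (s≤s z≤n) b′ k∉ , ≤-refl ∷ b′ , cong (suc k +_) s)

count-even : ∀ k → 2 ∣ suc k → ∀ i → count (suc k) (suc k + i) ≡ count k (suc k + i) + count (suc k) i
count-even k even = count-suc k (suc k) (λ b _ → b) (λ b → b , λ odd → ⊥-elim (odd even))

count-odd : ∀ k → Odd (suc k) → ∀ i → count (suc k) (suc k + i) ≡ count k (suc k + i) + count k i
count-odd k odd = count-suc k k
  (λ {qs} b k∉ → All.tabulate λ x∈ → s≤s⁻¹ (≤∧≢⇒< (All.lookup b x∈) λ x≡ → k∉ odd (subst (_∈ qs) x≡ x∈)))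
  (λ b → All.map m≤n⇒m≤1+n b , λ _ k∈ → 1+n≰n (All.lookup b k∈))

-- From triples to a product of three enumerations

-- Bracketed to the right like the nested pairs, so that `gf-×` applies twice.
weight : Triple → ℕ
weight (λ₁ , λ₂ , λ₃) = sum λ₁ + (sum λ₂ + sum λ₃)

-- All partitions of size at most `n` with distinct odd parts occur, but some larger ones may too.
-- Its generating polynomial is therefore reliable only up to degree `n`.
podsUpTo : ℕ → List (List ℕ)
podsUpTo n = filter isPOD? (boundedLists n n)

podsUpTo-unique : ∀ n → Unique (podsUpTo n)
podsUpTo-unique n = filter⁺ isPOD? (boundedLists-unique n n)

count-podsUpTo : ∀ {n i} → i ≤ n → length (filter (λ ps → sum ps ≟ i) (podsUpTo n)) ≡ count i i
count-podsUpTo {n} {i} i≤n = unique-length (filter⁺ (λ ps → sum ps ≟ i) (podsUpTo-unique n)) (pods-unique i i)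
  (λ ps ps∈ → let (ps∈′ , s) = ∈-filter⁻ (λ ps → sum ps ≟ i) {xs = podsUpTo n} ps∈ in
    ∈-pods⁺ (proj₂ (∈-filter⁻ isPOD? {xs = boundedLists n n} ps∈′) , subst (λ n → All (_≤ n) ps) s (parts≤sum ps) , s))
  (λ ps ps∈ → let (pod , _ , s) = ∈-pods⁻ {i} ps∈ in
    ∈-filter⁺ (λ ps → sum ps ≟ i) (∈-filter⁺ isPOD?
      (∈-boundedLists n n (proj₂ (proj₁ pod)) (≤-trans (≤-reflexive s) i≤n) (≤-trans (≤-reflexive s) i≤n)) pod) s)

pod₋₃-count : ∀ n → pod₋₃ n ≡
  length (filter (λ t → weight t ≟ n) (cartesianProduct (podsUpTo n) (cartesianProduct (podsUpTo n) (podsUpTo n))))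
pod₋₃-count n = unique-length (podTriples-unique n) (filter⁺ weight? (cartesianProduct⁺ u (cartesianProduct⁺ u u)))
  to from
  where
  B : List (List ℕ)
  B = podsUpTo n
  u : Unique B
  u = podsUpTo-unique n
  weight? : Decidable (λ t → weight t ≡ n)
  weight? t = weight t ≟ n
  inB : ∀ {ps} → IsPOD ps → sum ps ≤ n → ps ∈ B
  inB pod s≤n = ∈-filter⁺ isPOD? (∈-boundedLists n n (proj₂ (proj₁ pod)) s≤n s≤n) pod
  isPOD : ∀ {ps} → ps ∈ B → IsPOD ps
  isPOD ps∈ = proj₂ (∈-filter⁻ isPOD? {xs = boundedLists n n} ps∈)
  to : ∀ t → t ∈ podTriples n → t ∈ filter weight? (cartesianProduct B (cartesianProduct B B))
  to t@(λ₁ , λ₂ , λ₃) t∈ with Equivalence.to (∈-podTriples n t) t∈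
  ... | p₁ , p₂ , p₃ , s = ∈-filter⁺ weight?
      (∈-cartesianProduct⁺ (inB p₁ (m+n≤o⇒m≤o (sum λ₁) s′))
        (∈-cartesianProduct⁺ (inB p₂ (m+n≤o⇒m≤o (sum λ₂) s₂₃)) (inB p₃ (m+n≤o⇒n≤o (sum λ₂) s₂₃))))
      w
    where
    w : weight t ≡ n
    w = trans (sym (+-assoc (sum λ₁) (sum λ₂) (sum λ₃))) s
    s′ : sum λ₁ + (sum λ₂ + sum λ₃) ≤ n
    s′ = ≤-reflexive w
    s₂₃ : sum λ₂ + sum λ₃ ≤ n
    s₂₃ = m+n≤o⇒n≤o (sum λ₁) s′
  from : ∀ t → t ∈ filter weight? (cartesianProduct B (cartesianProduct B B)) → t ∈ podTriples n
  from t@(λ₁ , λ₂ , λ₃) t∈ =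
    let (t∈′ , w)   = ∈-filter⁻ weight? {xs = cartesianProduct B (cartesianProduct B B)} t∈
        (∈₁ , ∈₂₃)  = ∈-cartesianProduct⁻ B (cartesianProduct B B) t∈′
        (∈₂ , ∈₃)   = ∈-cartesianProduct⁻ B B ∈₂₃
    in Equivalence.from (∈-podTriples n t)
         (isPOD ∈₁ , isPOD ∈₂ , isPOD ∈₃ , trans (+-assoc (sum λ₁) (sum λ₂) (sum λ₃)) w)

-- The ring of integers modulo 9 on the carrier ℕ, so that counts are elements of it

infix 4 _≡₉_
record _≡₉_ (m n : ℕ) : Set where
  constructor residue
  field %9 : m % 9 ≡ n % 9
open _≡₉_

≡⇒≡₉ : ∀ {m n} → m ≡ n → m ≡₉ n
≡⇒≡₉ p = residue (cong (_% 9) p)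

+-cong₉ : ∀ {a b c d} → a ≡₉ b → c ≡₉ d → a + c ≡₉ b + d
+-cong₉ {a} {b} {c} {d} (residue p) (residue q) = residue (trans (%-distribˡ-+ a c 9)
  (trans (cong₂ (λ x y → (x + y) % 9) p q) (sym (%-distribˡ-+ b d 9))))

*-cong₉ : ∀ {a b c d} → a ≡₉ b → c ≡₉ d → a * c ≡₉ b * d
*-cong₉ {a} {b} {c} {d} (residue p) (residue q) = residue (trans (%-distribˡ-* a c 9)
  (trans (cong₂ (λ x y → (x * y) % 9) p q) (sym (%-distribˡ-* b d 9))))

9*≡₉0 : ∀ n → 9 * n ≡₉ 0
9*≡₉0 n = *-cong₉ {9} {0} {n} {n} (residue refl) (residue refl)

ℤ/9 : CommutativeRing 0ℓ 0ℓ
ℤ/9 = record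
  { Carrier = ℕ
  ; _≈_ = _≡₉_
  ; _+_ = _+_
  ; _*_ = _*_
  ; -_ = 8 *_
  ; 0# = 0
  ; 1# = 1
  ; isCommutativeRing = record
    { isRing = record
      { +-isAbelianGroup = record
        { isGroup = record
          { isMonoid = record
            { isSemigroup = record
              { isMagma = record
                { isEquivalence = record
                  { refl = residue refl
                  ; sym = λ p → residue (sym (%9 p))
                  ; trans = λ p q → residue (trans (%9 p) (%9 q))
                  }
                ; ∙-cong = +-cong₉
                }
              ; assoc = λ a b c → ≡⇒≡₉ (+-assoc a b c)
              }
            ; identity = (λ a → residue refl) , (λ a → ≡⇒≡₉ (+-identityʳ a))
            }
          ; inverse = (λ a → subst (_≡₉ 0) (+-comm a (8 * a)) (9*≡₉0 a)) , 9*≡₉0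
          ; ⁻¹-cong = *-cong₉ {8} {8} (residue refl)
          }
        ; comm = λ a b → ≡⇒≡₉ (+-comm a b)
        }
      ; *-cong = *-cong₉
      ; *-assoc = λ a b c → ≡⇒≡₉ (*-assoc a b c)
      ; *-identity = (λ a → ≡⇒≡₉ (*-identityˡ a)) , (λ a → ≡⇒≡₉ (*-identityʳ a))
      ; distrib = (λ a b c → ≡⇒≡₉ (*-distribˡ-+ a b c)) , (λ a b c → ≡⇒≡₉ (*-distribʳ-+ a b c))
      }
    ; *-comm = λ a b → ≡⇒≡₉ (*-comm a b)
    }
  }

9≈0 : NineVanishes ℤ/9
9≈0 = residue refl

open PowerSeries ℤ/9
open SeriesModNine ℤ/9 9≈0
open Triangular ℤ/9 9≈0
open Congruences ℤ/9 9≈0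
private
  module R = CommutativeRing ℤ/9
  module S = CommutativeRing series
open import Algebra.Properties.Semiring.Exp S.semiring using () renaming (_^_ to _^ˢ_; ^-homo-* to ^ˢ-homo-*)
import Relation.Binary.Reasoning.Setoid S.setoid as S-Reasoning

-- Generating functions of finite lists

gf : ∀ {a} {A : Set a} → (A → ℕ) → List A → Series
gf w []       = 𝟘
gf w (x ∷ xs) = X ^ˢ w x ⊕ gf w xs

gf-++ : ∀ {a} {A : Set a} (w : A → ℕ) xs ys → gf w (xs ++ ys) ≋ gf w xs ⊕ gf w ys
gf-++ w []       ys = S.sym (S.+-identityˡ (gf w ys))
gf-++ w (x ∷ xs) ys = S.trans (S.+-congˡ (gf-++ w xs ys)) (S.sym (S.+-assoc (X ^ˢ w x) (gf w xs) (gf w ys)))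

gf-pair : ∀ {a b} {A : Set a} {B : Set b} (v : A → ℕ) (w : B → ℕ) x ys →
          gf (λ (x , y) → v x + w y) (map (x ,_) ys) ≋ X ^ˢ v x ⊛ gf w ys
gf-pair v w x []       = S.sym (S.zeroʳ (X ^ˢ v x))
gf-pair v w x (y ∷ ys) = S.trans (S.+-cong (^ˢ-homo-* X (v x) (w y)) (gf-pair v w x ys))
  (S.sym (S.distribˡ (X ^ˢ v x) (X ^ˢ w y) (gf w ys)))

gf-× : ∀ {a b} {A : Set a} {B : Set b} (v : A → ℕ) (w : B → ℕ) xs ys →
       gf (λ (x , y) → v x + w y) (cartesianProduct xs ys) ≋ gf v xs ⊛ gf w ys
gf-× v w []       ys = S.sym (S.zeroˡ (gf w ys))
gf-× v w (x ∷ xs) ys = S.trans (gf-++ _ (map (x ,_) ys) (cartesianProduct xs ys))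
  (S.trans (S.+-cong (gf-pair v w x ys) (gf-× v w xs ys)) (S.sym (S.distribʳ (gf w ys) (X ^ˢ v x) (gf v xs))))

X^-≡ : ∀ k → (X ^ˢ k) k ≡₉ 1
X^-≡ k = R.trans (R.sym (at (S.*-identityʳ (X ^ˢ k)) k))
  (R.trans (≡⇒≡₉ (cong (X ^ˢ k ⊛ 𝟙) (sym (+-identityʳ k)))) (X^⊛-+ k 𝟙 0))

X^-≢ : ∀ k n → ¬ k ≡ n → (X ^ˢ k) n ≡₉ 0
X^-≢ k n k≢n with k ℕ.≤? n
... | no k≰n = R.trans (R.sym (at (S.*-identityʳ (X ^ˢ k)) n)) (vanish-^ X R.refl k 𝟙 n (≰⇒> k≰n))
... | yes k≤n with n ℕ.∸ k | m+[n∸m]≡n k≤n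
...   | zero  | eq = ⊥-elim (k≢n (trans (sym (+-identityʳ k)) eq))
...   | suc i | refl = R.trans (R.sym (at (S.*-identityʳ (X ^ˢ k)) (k + suc i))) (X^⊛-+ k 𝟙 (suc i))

gf-coefficient : ∀ {a} {A : Set a} (w : A → ℕ) xs n → gf w xs n ≡₉ length (filter (λ x → w x ≟ n) xs)
gf-coefficient w []       n = R.refl
gf-coefficient {A = A} w (x ∷ xs) n = go (w x ≟ n)
  where
  weight-n? : ∀ x → Dec (w x ≡ n)
  weight-n? x = w x ≟ n
  go : Dec (w x ≡ n) → gf w (x ∷ xs) n ≡₉ length (filter weight-n? (x ∷ xs))
  go (yes refl) = R.trans (R.+-cong (X^-≡ (w x)) (gf-coefficient w xs n))
    (≡⇒≡₉ (cong length (sym (filter-accept weight-n? refl))))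
  go (no w≢n) = R.trans (R.+-cong (X^-≢ (w x) n w≢n) (gf-coefficient w xs n))
    (≡⇒≡₉ (cong length (sym (filter-reject weight-n? w≢n))))

-- The series of partitions with distinct odd parts

P : Series
P n = count n n

-- The polynomial of the finite list agrees with `P` up to degree `n`, and no higher coefficient
-- reaches degree `n` of the cube.
pod₋₃≡₉P³ : ∀ n → pod₋₃ n ≡₉ (P ⊛ P ⊛ P) n
pod₋₃≡₉P³ n = R.trans (≡⇒≡₉ (pod₋₃-count n)) (R.trans (R.sym (gf-coefficient weight (cartesianProduct B (cartesianProduct B B)) n))
  (R.trans (at (S.trans (gf-× sum _ B (cartesianProduct B B)) (S.trans (S.*-congˡ (gf-× sum sum B B))
     (S.sym (S.*-assoc (gf sum B) (gf sum B) (gf sum B))))) n)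
   (⊛-cong-≤ n (λ i i≤n → ⊛-cong-≤ i (λ j j≤i → B≈P j (≤-trans j≤i i≤n)) (λ j j≤i → B≈P j (≤-trans j≤i i≤n))) B≈P)))
  where
  B : List (List ℕ)
  B = podsUpTo n
  B≈P : ∀ i → i ≤ n → gf sum B i ≡₉ P i
  B≈P i i≤n = R.trans (gf-coefficient sum B i) (≡⇒≡₉ (count-podsUpTo i≤n))

count-series : ∀ k k′ → (∀ i → count (suc k) (suc k + i) ≡ count k (suc k + i) + count k′ i) →
               count (suc k) ≋ count k ⊕ X ^ˢ suc k ⊛ count k′
count-series k k′ step = pointwise coefficient
  where
  coefficient : ∀ n → count (suc k) n ≡₉ (count k ⊕ X ^ˢ suc k ⊛ count k′) n
  coefficient n with suc k ℕ.≤? n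
  -- Below degree `suc k` the shifted series contributes nothing, and both bounds are already
  -- saturated.
  ... | no k≮n = R.trans (≡⇒≡₉ (trans (count-below (≮⇒≥ k≮n)) (sym (+-identityʳ (count k n)))))
    (R.+-congˡ (R.sym (vanish-^ X R.refl (suc k) (count k′) n (≰⇒> k≮n))))
  ... | yes k<n with n ℕ.∸ suc k | m+[n∸m]≡n k<n
  ...   | i | refl = R.trans (≡⇒≡₉ (step i)) (R.+-congˡ (R.sym (X^⊛-+ (suc k) (count k′) i)))

2∤1+2m : ∀ m → Odd (suc (2 * m))
2∤1+2m m 2∣ = >⇒∤ (s≤s (s≤s z≤n)) (∣m+n∣m⇒∣n (subst (2 ∣_) (+-comm 1 (2 * m)) 2∣) (m∣m*n m))

-- Raising the bound by 2 admits one odd and one even part size, which together give the ratio (1 -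
-- q^(2m+1)) / (1 - q^(2m+2)) of the Shanks recurrence.
G : ℕ → Series
G m = count (2 * m)

G-suc : ∀ m → 1-q^ (2 + 2 * m) ⊛ G (suc m) ≋ 1-q^ (1 + 2 * m) ⊛ G m
G-suc m = subst (λ k → 1-q^ (2 + 2 * m) ⊛ count k ≋ 1-q^ (1 + 2 * m) ⊛ G m) (sym (*-suc 2 m))
  (recurrence m (count-series (2 * m) (2 * m) (count-odd (2 * m) (2∤1+2m m)))
    (count-series (1 + 2 * m) (2 + 2 * m) (count-even (1 + 2 * m) (subst (2 ∣_) (*-suc 2 m) (m∣m*n (suc m))))))

G₀≋1 : G 0 ≋ 𝟙
G₀≋1 = pointwise λ where
  zero    → ≡⇒≡₉ count-0-0
  (suc n) → ≡⇒≡₉ (count-0-suc n)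

G≋P : ∀ n → G n ≋[ suc (2 * n) ] P
G≋P n i (s≤s i≤2n) = ≡⇒≡₉ (count-saturated i≤2n)

open Shanks G G₀≋1 G-suc
open Limit P G≋P

-- Arithmetic of the exponents

3^[2+k] : ∀ b k → 3 ^ (2 * suc b + k) ≡ 9 * 3 ^ (2 * b + k)
3^[2+k] b k = trans (cong (λ e → 3 ^ (e + k)) (*-suc 2 b)) (sym (*-assoc 3 3 (3 ^ (2 * b + k))))

index-shift : ∀ b n → index b n ≡ 3 ^ (2 * b + 1) * n + index b 0
index-shift zero    n = arith n
  where
  arith : ∀ n → 2 + n * 3 ≡ 3 * n + 2
  arith = ℕ-solve
index-shift (suc b) n rewrite 3^[2+k] b 1 =
  trans (cong (λ i → 1 + (2 + i * 3) * 3) (index-shift b n)) (arith (3 ^ (2 * b + 1)) n (index b 0))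
  where
  arith : ∀ p n i → 1 + (2 + (p * n + i) * 3) * 3 ≡ 9 * p * n + (1 + (2 + i * 3) * 3)
  arith = ℕ-solve

-- Three times the relation 8 k + 7 = 9^b (24 n + 23) at n = 0.
23*3^[2b+1] : ∀ b → 23 * 3 ^ (2 * b + 1) ≡ 24 * index b 0 + 21
23*3^[2b+1] zero    = refl
23*3^[2b+1] (suc b) rewrite 3^[2+k] b 1 = trans (arith₁ (3 ^ (2 * b + 1)))
  (trans (cong (9 *_) (23*3^[2b+1] b)) (arith₂ (index b 0)))
  where
  arith₁ : ∀ p → 23 * (9 * p) ≡ 9 * (23 * p)
  arith₁ = ℕ-solve
  arith₂ : ∀ i → 9 * (24 * i + 21) ≡ 24 * (1 + (2 + i * 3) * 3) + 21
  arith₂ = ℕ-solve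

exponent : ∀ b n → 3 ^ (2 * suc b + 2) * n + (23 * 3 ^ (2 * suc b + 1) + 3) / 8 ≡ (2 + (2 + index b n * 3) * 3) * 3
exponent b n = go (3 ^ (2 * b + 1)) (index b 0) power (23*3^[2b+1] (suc b)) (index-shift b n)
  where
  power : 3 ^ (2 * suc b + 2) ≡ 27 * 3 ^ (2 * b + 1)
  power = trans (3^[2+k] b 2) (trans (cong (λ e → 9 * 3 ^ e) (+-suc (2 * b) 1)) (sym (*-assoc 9 3 (3 ^ (2 * b + 1)))))
  arith₁ : ∀ i → 24 * (1 + (2 + i * 3) * 3) + 21 + 3 ≡ (24 + 27 * i) * 8
  arith₁ = ℕ-solve
  arith₂ : ∀ p n i → 27 * p * n + (24 + 27 * i) ≡ (2 + (2 + (p * n + i) * 3) * 3) * 3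
  arith₂ = ℕ-solve
  go : ∀ p i {x y k} → x ≡ 27 * p → y ≡ 24 * (1 + (2 + i * 3) * 3) + 21 → k ≡ p * n + i →
       x * n + (y + 3) / 8 ≡ (2 + (2 + k * 3) * 3) * 3
  -- With the powers abstracted to variables, the numerator is 8 (24 + 27 i), so the division is
  -- exact and only a polynomial identity remains.
  go p i refl refl refl = trans
    (cong (27 * p * n +_) (trans (cong (_/ 8) (arith₁ i)) (m*n/n≡m (24 + 27 * i) 8))) (arith₂ p n i)

9∣pod₋₃ : ∀ N → (P ⊛ P ⊛ P) N ≡₉ 0 → 9 ∣ pod₋₃ N
9∣pod₋₃ N p = m%n≡0⇒n∣m (pod₋₃ N) 9 (%9 (R.trans {pod₋₃ N} (pod₋₃≡₉P³ N) p))

theorem2p3 : ∀ (α n : ℕ) → α ≥ 1 →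
    9 ∣ pod₋₃ (3 ^ (2 * α + 2) * n + (23 * 3 ^ (2 * α + 1) + 3) / 8)
theorem2p3 (suc b) n _ = subst (λ N → 9 ∣ pod₋₃ N) (sym (exponent b n))
  (9∣pod₋₃ ((2 + (2 + index b n * 3) * 3) * 3) (P³-vanishes φΠ₁≋Π₂ P φP≈1 b n))
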